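{- Let $n$ be a positive even integer and let $A$ be an adjacency matrix of the $n$-cube graph $Q_n$. Then for every integer $i\geq 0$, the multiplicity of $2^i$ as a $2$-elementary divisor of $A$ is equal to the number of eigenvalues of $A$ (counted with multiplicity) whose exact $2$-power divisor is $2^{i+1}$, i.e. the number of eigenvalues that are divisible by $2^{i+1}$ and not by $2^{i+2}$.
   Context: The $n$-cube graph $Q_n$ has vertex set $\{0,1\}^n$, with two vertices joined by an edge if and only if the $n$-tuples differ in exactly one component. All eigenvalues of $A$ are integers. For a prime $p$ and an integer $i\ge 0$, the multiplicity of $p^i$ as a $p$-elementary divisor of an integral matrix $X$ is the number of nonzero diagonal entries of the Smith normal form of $X$ (equivalently, of any diagonal matrix equivalent to $X$ over $\mathbb{Z}$, or over the localization $\mathbb{Z}_{(p)}$) that are divisible by $p^i$ but not by $p^{i+1}$. -}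

module Defs where

import Algebra.Properties.Monoid.Sum as Sum
open import Data.Bool.Base using (Bool; if_then_else_)
open import Data.Fin.Base using (Fin)
open import Data.Fin.Properties using (_≟_)
open import Data.Integer.Base using (ℤ; +_; 0ℤ; 1ℤ)
import Data.Integer.Base as ℤ
import Data.Integer.Properties as ℤ
open import Data.Integer.Divisibility.Signed using (_∣_; _∣?_)
open import Data.Nat.Base using (ℕ; suc; _^_)
open import Data.Product using (∃-syntax; ∃!; _×_)
open import Data.Rational.Base using (ℚ; 0ℚ; _/_)
import Data.Rational.Base as ℚ
import Data.Rational.Properties as ℚ
open import Data.Vec.Base using (Vec; lookup; tabulate; count)
open import Function.Bundles using (_⤖_; Bijection)
open import Relation.Binary.PropositionalEquality.Core using (_≡_; _≢_)
open import Relation.Nullary using (¬_; does)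
open import Relation.Nullary.Decidable using (¬?; _×-dec_)
open import Relation.Unary using (Decidable)

open Sum ℤ.+-0-monoid public using () renaming (sum to sumℤ)
open Sum ℚ.+-0-monoid public using () renaming (sum to sumℚ)

Matrix : Set → ℕ → Set
Matrix R N = Fin N → Fin N → R

infix 4 _≈_
_≈_ : ∀ {N} → Matrix ℤ N → Matrix ℤ N → Set
X ≈ Y = ∀ i j → X i j ≡ Y i j

infixl 7 _∙_
_∙_ : ∀ {N} → Matrix ℤ N → Matrix ℤ N → Matrix ℤ N
(X ∙ Y) i j = sumℤ (λ k → X i k ℤ.* Y k j)

identity : ∀ {N} → Matrix ℤ N
identity i j = if does (i ≟ j) then 1ℤ else 0ℤ

Unimodular : ∀ {N} → Matrix ℤ N → Set
Unimodular P = ∃[ P⁻¹ ] (P ∙ P⁻¹ ≈ identity × P⁻¹ ∙ P ≈ identity)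

Equivalent : ∀ {N} → Matrix ℤ N → Matrix ℤ N → Set
Equivalent X Y =
  ∃[ P ] ∃[ Q ] (Unimodular P × Unimodular Q × P ∙ X ∙ Q ≈ Y)

IsDiagonal : ∀ {N} → Matrix ℤ N → Set
IsDiagonal D = ∀ i j → i ≢ j → D i j ≡ 0ℤ

diagonal : ∀ {N} → Matrix ℤ N → Vec ℤ N
diagonal D = tabulate (λ i → D i i)

-- Zero is never exactly divisible by a power, as every integer divides it.
ExactlyDivides : ℕ → ℕ → ℤ → Set
ExactlyDivides p i z = (+ (p ^ i)) ∣ z × ¬ (+ (p ^ suc i)) ∣ z

exactlyDivides? : ∀ p i → Decidable (ExactlyDivides p i)
exactlyDivides? p i z = (+ (p ^ i)) ∣? z ×-dec ¬? ((+ (p ^ suc i)) ∣? z)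

-- The multiplicity of p^i as a p-elementary divisor of X is m.  The count may
-- be read off from any diagonal matrix equivalent to X over ℤ, in particular
-- from the Smith normal form: the result depends only on X.
ElementaryDivisorMultiplicity : ∀ {N} → ℕ → ℕ → Matrix ℤ N → ℕ → Set
ElementaryDivisorMultiplicity p i X m =
  ∃[ D ] (IsDiagonal D × Equivalent X D ×
          count (exactlyDivides? p i) (diagonal D) ≡ m)

fromℤ : ℤ → ℚ
fromℤ z = z / 1

InEigenspace : ∀ {N} → Matrix ℤ N → ℤ → (Fin N → ℚ) → Set
InEigenspace A θ v =
  ∀ i → sumℚ (λ j → fromℤ (A i j) ℚ.* v j) ≡ fromℤ θ ℚ.* v i

combination : ∀ {m N} → (Fin m → ℚ) → (Fin m → Fin N → ℚ) → Fin N → ℚ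
combination c b i = sumℚ (λ k → c k ℚ.* b k i)

LinearlyIndependent : ∀ {m N} → (Fin m → Fin N → ℚ) → Set
LinearlyIndependent b =
  ∀ c → (∀ i → combination c b i ≡ 0ℚ) → ∀ k → c k ≡ 0ℚ

-- The eigenspace of an integral matrix for an integer θ is cut out by rational
-- equations, so its dimension is the same over ℚ as over ℝ or ℂ.
record EigenspaceBasis {N} (A : Matrix ℤ N) (θ : ℤ) (m : ℕ) : Set where
  field
    basis       : Fin m → Fin N → ℚ
    eigen       : ∀ k → InEigenspace A θ (basis k)
    independent : LinearlyIndependent basis
    spanning    : ∀ v → InEigenspace A θ v →
                  ∃[ c ] (∀ i → v i ≡ combination c basis i)

-- The N entries of θs are the eigenvalues of A, each repeated according to the
-- dimension of its eigenspace.  This is meant for real symmetric matrices with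
-- integral spectrum, where geometric and algebraic multiplicities agree; an
-- integer that is not an eigenvalue has a zero eigenspace and does not occur.
IsSpectrum : ∀ {N} → Matrix ℤ N → Vec ℤ N → Set
IsSpectrum A θs = ∀ θ → EigenspaceBasis A θ (count (θ ℤ.≟_) θs)

CubeVertex : ℕ → Set
CubeVertex n = Vec Bool n

CubeAdjacent : ∀ {n} → CubeVertex n → CubeVertex n → Set
CubeAdjacent u v = ∃! _≡_ (λ k → lookup u k ≢ lookup v k)

-- An adjacency matrix of the n-cube, for some ordering of the vertices.
record IsCubeAdjacencyMatrix (n : ℕ) (A : Matrix ℤ (2 ^ n)) : Set where
  field
    ordering : Fin (2 ^ n) ⤖ CubeVertex n

  vertex : Fin (2 ^ n) → CubeVertex n
  vertex = Bijection.to ordering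

  field
    adjacent    : ∀ i j → CubeAdjacent (vertex i) (vertex j) → A i j ≡ 1ℤ
    nonadjacent : ∀ i j → ¬ CubeAdjacent (vertex i) (vertex j) → A i j ≡ 0ℤ

-- Vectors indexed by the vertices of the cube are polynomials in x₁, …, xₙ with
-- xᵢ² = 1, and A is the multiplication by s = x₁ + … + xₙ.  Let eₖ be the
-- elementary symmetric polynomials of the 1 + xᵢ and n = 2r.  The coefficients
-- cₖ of (Σ eₖ tᵏ) / (1 + 2t)ʳ, formally the power series (1 + 2t)^(s/2), satisfy
-- s cₖ = (k + 1) cₖ₊₁ + 2k cₖ, so that s pₖ = k cₖ for
-- pₖ = cₖ₋₁ − 2cₖ₋₂ + 4cₖ₋₃ − …, whereas cₖ ≡ eₖ and pₖ₊₁ ≡ eₖ modulo 2.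
--
-- Let H = 2^(i+1).  On the one hand, if g lies modulo 2 in the ideal generated
-- by e₁, …, e_{H−1}, then 2ⁱ g is in the image of A modulo H.  On the other hand,
-- A annihilates modulo H the products of factors xₐ − x_b in some of the
-- variables with p_H, or with factors xₐ x_b − 1, in the remaining ones.
-- Comparing lexicographically leading monomials, the former span modulo 2 at
-- least as many dimensions as there are paths of n steps ±1 from 0 that reach −1
-- before H − 1, and the latter at least as many as there are other paths.  These
-- numbers add up to 2ⁿ, so both bounds are sharp and the second one is the number
-- of elementary divisors divisible by H.  By the reflection principle it is also
-- the number of paths that end at a multiple of 2H, and the ends of the paths are
-- the eigenvalues of A.
module Submission where

open import Algebra.Bundles using (CommutativeMonoid; CommutativeRing)
import Algebra.Properties.CommutativeMonoid.Sum
import Algebra.Properties.Ring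
import Algebra.Properties.Semiring.Sum
open import Data.Bool.Base using (Bool; true; false; not; if_then_else_; _xor_)
import Data.Bool.Properties as Bool
open import Data.Empty using (⊥)
open import Data.Fin.Base using (Fin; zero; suc; punchIn; _↑ˡ_; _↑ʳ_; splitAt)
import Data.Fin.Properties as Fin
open import Data.Nat.Base as ℕ using (ℕ; zero; suc; _^_; _≤_; _<_; z≤n; s≤s; z<s; s<s; s≤s⁻¹; s<s⁻¹; NonZero)
import Data.Nat.Properties as ℕ
open import Data.Product using (∃-syntax; Σ-syntax; _×_; _,_; proj₁; proj₂)
open import Data.Sum.Base as Sum using (_⊎_; inj₁; inj₂; [_,_]′)
import Data.Vec.Functional as Functional using (insertAt; _++_)
import Data.Vec.Functional.Properties as Functional
open import Function.Base using (_∘_; id; case_of_)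
open import Function.Bundles using (_⤖_; Bijection)
open import Level using (0ℓ)
import Relation.Binary.Reasoning.Setoid
open import Relation.Binary.PropositionalEquality
  using (_≡_; _≢_; refl; sym; trans; cong; cong₂; subst; subst₂; module ≡-Reasoning)
open import Relation.Nullary using (¬_; Dec; yes; no; does; contradiction)
open import Relation.Nullary.Decidable as Dec
  using (¬?; _×-dec_; decidable-stable; dec-true; dec-false)
open import Relation.Unary using (Pred; Decidable)

-- Linear equations over an integral domain

module Elimination {c ℓ} (R : CommutativeRing c ℓ) where

  open CommutativeRing R hiding (zero)
    renaming (refl to ≈-refl; sym to ≈-sym; trans to ≈-trans)
  open Algebra.Properties.Semiring.Sum semiring
  open Algebra.Properties.Ring ring using (-‿distribʳ-*; -‿distribˡ-*)
  open Relation.Binary.Reasoning.Setoid setoid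

  private
    infix 8 _·_
    _·_ : ∀ {k} → (Fin k → Carrier) → (Fin k → Carrier) → Carrier
    u · v = sum (λ l → u l * v l)

    ·-zero : ∀ {k} (u v : Fin k → Carrier) → (∀ l → v l ≈ 0#) → u · v ≈ 0#
    ·-zero {k} u v v≈0 =
      ≈-trans (sum-cong-≋ (λ l → ≈-trans (*-congˡ (v≈0 l)) (zeroʳ (u l)))) (sum-replicate-zero k)

    -- Cross multiplication with the pivot e p removes coordinate p without any division, as is
    -- required over a commutative ring.
    eliminate : ∀ {k} → Fin (suc k) → (e f : Fin (suc k) → Carrier) → Fin k → Carrier
    eliminate p e f l = e p * f (punchIn p l) - e (punchIn p l) * f p

    -- The adjoint of `eliminate`: the coordinate at p is chosen so that the pairing with e
    -- vanishes, and the others are scaled by the pivot to avoid dividing by it.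
    extend : ∀ {k} → Fin (suc k) → (Fin (suc k) → Carrier) → (Fin k → Carrier) → Fin (suc k) → Carrier
    extend p e u = Functional.insertAt (λ l → e p * u l) p (- (u · (λ l → e (punchIn p l))))

    extend-· : ∀ {k} p (e f : Fin (suc k) → Carrier) u →
               extend p e u · f ≈ u · eliminate p e f
    extend-· p e f u = begin
      extend p e u · f
        ≈⟨ sum-remove {i = p} (λ l → extend p e u l * f l) ⟩
      extend p e u p * f p + sum (λ l → extend p e u (punchIn p l) * f (punchIn p l))
        ≈⟨ +-cong (*-congʳ (reflexive (Functional.insertAt-lookup _ p _)))
                  (sum-cong-≋ (λ l → *-congʳ (reflexive (Functional.insertAt-punchIn _ p _ l)))) ⟩
      - S * f p + sum (λ l → e p * u l * f (punchIn p l))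
        ≈⟨ +-congʳ (≈-trans (≈-sym (-‿distribˡ-* S (f p))) (-‿distribʳ-* S (f p))) ⟩
      S * - f p + sum (λ l → e p * u l * f (punchIn p l))
        ≈⟨ +-congʳ (*-distribʳ-sum (- f p) (λ l → u l * e (punchIn p l))) ⟩
      sum (λ l → u l * e (punchIn p l) * - f p) + sum (λ l → e p * u l * f (punchIn p l))
        ≈⟨ ∑-distrib-+ (λ l → u l * e (punchIn p l) * - f p) _ ⟨
      sum (λ l → u l * e (punchIn p l) * - f p + e p * u l * f (punchIn p l))
        ≈⟨ sum-cong-≋ regroup ⟩
      u · eliminate p e f ∎
      where
      S = u · (λ l → e (punchIn p l))
      regroup : ∀ l → u l * e (punchIn p l) * - f p + e p * u l * f (punchIn p l) ≈ u l * eliminate p e f l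
      regroup l = begin
        u l * e (punchIn p l) * - f p + e p * u l * f (punchIn p l)
          ≈⟨ +-comm _ _ ⟩
        e p * u l * f (punchIn p l) + u l * e (punchIn p l) * - f p
          ≈⟨ +-cong (≈-trans (*-congʳ (*-comm (e p) (u l))) (*-assoc (u l) (e p) _))
                    (≈-trans (*-assoc (u l) _ _) (*-congˡ (≈-sym (-‿distribʳ-* _ (f p))))) ⟩
        u l * (e p * f (punchIn p l)) + u l * - (e (punchIn p l) * f p)
          ≈⟨ distribˡ (u l) _ _ ⟨
        u l * eliminate p e f l ∎

  module _ (zero? : ∀ x → Dec (x ≈ 0#))
           (noZeroDivisors : ∀ {x y} → x * y ≈ 0# → x ≈ 0# ⊎ y ≈ 0#)
           (1≉0 : ¬ 1# ≈ 0#) where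

    -- Fraction-free Gaussian elimination by induction on the number of equations: a zero equation
    -- is dropped, otherwise a pivot removes one equation and one unknown.
    nontrivialSolution : ∀ {m k} (M : Fin m → Fin k → Carrier) → m < k →
                         Σ[ u ∈ (Fin k → Carrier) ] (∃[ l ] ¬ u l ≈ 0#) × (∀ i → sum (λ l → u l * M i l) ≈ 0#)
    nontrivialSolution {zero} {suc k} M _ = (λ _ → 1#) , (zero , 1≉0) , λ ()
    nontrivialSolution {suc m} {suc k} M m<k with Fin.any? (λ l → ¬? (zero? (M zero l)))
    ... | no M₀≈0 with nontrivialSolution (λ i → M (suc i)) (ℕ.<-trans (ℕ.n<1+n _) m<k)
    ...   | u , u≉0 , sol = u , u≉0 , λ
            { zero    → ·-zero u (M zero) (λ l → decidable-stable (zero? _) (λ M₀l≉0 → M₀≈0 (l , M₀l≉0)))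
            ; (suc i) → sol i
            }
    nontrivialSolution {suc m} {suc k} M m<k | yes (p , pivot≉0)
      with nontrivialSolution (λ i → eliminate p (M zero) (M (suc i))) (s<s⁻¹ m<k)
    ... | u , (l , ul≉0) , sol = extend p (M zero) u
      -- The value at `punchIn p l` is the pivot times u l, nonzero in the absence of zero divisors.
      , ( punchIn p l
        , λ v≈0 → [ pivot≉0 , ul≉0 ]′ (noZeroDivisors
            (≈-trans (reflexive (sym (Functional.insertAt-punchIn (λ j → M zero p * u j) p _ l))) v≈0)))
      , λ { zero    → ≈-trans (extend-· p (M zero) (M zero) u)
                            (·-zero u _ (λ l → ≈-trans
                              (+-congʳ (*-comm (M zero p) (M zero (punchIn p l)))) (-‿inverseʳ _)))
          ; (suc i) → ≈-trans (extend-· p (M zero) (M (suc i)) u) (sol i)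
          }

open import Defs
import Data.Integer.Base as ℤ using (∣_∣)
open import Data.Integer.Base using (ℤ; +_; 0ℤ; 1ℤ; -1ℤ; _+_; _*_; -_; _-_)
open import Data.Integer.Divisibility.Signed renaming (_∣_ to _∣ℤ_)
import Data.Integer.Properties as ℤ
open import Data.Integer.Tactic.RingSolver using (solve-∀)
open import Data.List.Base as List using (List; []; _∷_; _++_; filter; length; map)
open import Data.List.Membership.Propositional using (_∈_)
open import Data.List.Membership.Propositional.Properties
  using (∈-++⁺ˡ; ∈-++⁺ʳ; ∈-map⁺; ∈-filter⁺; ∈-filter⁻; ∈-∃++)
import Data.List.Properties as List
open import Data.List.Relation.Binary.Permutation.Propositional
  using (_↭_; ↭-refl; ↭-sym; ↭-trans; prep)
open import Data.List.Relation.Binary.Permutation.Propositional.Properties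
  using (shift; ↭-length; filter-↭)
open import Data.List.Relation.Unary.All using (All; []; _∷_)
import Data.List.Relation.Unary.All.Properties as All
open import Data.List.Relation.Unary.Any using (here; index)
open import Data.List.Relation.Unary.Any.Properties using (lookup-index)
import Data.Nat.Coprimality as Coprime
open import Data.Nat.Divisibility as ℕ using (_∣_)
open import Data.Nat.Primality using (prime[2]; euclidsLemma)
open import Data.Nat.Tactic.RingSolver using () renaming (solve-∀ to solveℕ-∀)
open import Data.Rational.Base as ℚ using (ℚ; 0ℚ; 1ℚ; ½; mkℚ; ↥_; 1/_; ≢-nonZero)
import Data.Rational.Properties as ℚ
open import Data.Rational.Solver using (module +-*-Solver)
open import Data.Vec.Base as Vec
  using (Vec; []; _∷_; count; lookup; replicate; tabulate; toList; zipWith)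
import Data.Vec.Properties as Vec

private variable
  n k l a N : ℕ
  d : ℤ

open import Algebra.Properties.Monoid.Sum ℤ.+-0-monoid
  using () renaming (sum-cong-≗ to sumℤ-cong)
open Algebra.Properties.Semiring.Sum ℤ.+-*-semiring
  using (*-distribˡ-sum; *-distribʳ-sum; ∑-comm)

-- Integers modulo d

infix 4 _≡_[mod_]
record _≡_[mod_] (x y d : ℤ) : Set where
  constructor mod
  field difference : d ∣ℤ x - y

module _ {d : ℤ} where

  private
    via : ∀ {x y z} → z ≡ x - y → d ∣ℤ z → x ≡ y [mod d ]
    via eq p = mod (subst (d ∣ℤ_) eq p)

  mod-reflexive : ∀ {x y} → x ≡ y → x ≡ y [mod d ]
  mod-reflexive {x} refl = mod (divides 0ℤ (ℤ.+-inverseʳ x))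

  mod-refl : ∀ {x} → x ≡ x [mod d ]
  mod-refl = mod-reflexive refl

  mod-sym : ∀ {x y} → x ≡ y [mod d ] → y ≡ x [mod d ]
  mod-sym {x} {y} (mod p) = via (lemma x y) (∣m⇒∣-m p)
    where
    lemma : ∀ x y → - (x - y) ≡ y - x
    lemma = solve-∀

  mod-trans : ∀ {x y z} → x ≡ y [mod d ] → y ≡ z [mod d ] → x ≡ z [mod d ]
  mod-trans {x} {y} {z} (mod p) (mod q) = via (lemma x y z) (∣m∣n⇒∣m+n p q)
    where
    lemma : ∀ x y z → (x - y) + (y - z) ≡ x - z
    lemma = solve-∀

  mod-+ : ∀ {x y u v} → x ≡ y [mod d ] → u ≡ v [mod d ] → x + u ≡ y + v [mod d ]
  mod-+ {x} {y} {u} {v} (mod p) (mod q) = via (lemma x y u v) (∣m∣n⇒∣m+n p q)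
    where
    lemma : ∀ x y u v → (x - y) + (u - v) ≡ (x + u) - (y + v)
    lemma = solve-∀

  mod-* : ∀ {x y u v} → x ≡ y [mod d ] → u ≡ v [mod d ] → x * u ≡ y * v [mod d ]
  mod-* {x} {y} {u} {v} (mod p) (mod q) =
    via (lemma x y u v) (∣m∣n⇒∣m+n (∣m⇒∣m*n u p) (∣n⇒∣m*n y q))
    where
    lemma : ∀ x y u v → (x - y) * u + y * (u - v) ≡ x * u - y * v
    lemma = solve-∀

  mod-neg : ∀ {x y} → x ≡ y [mod d ] → - x ≡ - y [mod d ]
  mod-neg {x} {y} (mod p) = via (lemma x y) (∣m⇒∣-m p)
    where
    lemma : ∀ x y → - (x - y) ≡ - x - - y
    lemma = solve-∀

  ∣⇒mod : ∀ {x} → d ∣ℤ x → x ≡ 0ℤ [mod d ]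
  ∣⇒mod {x} = via (sym (ℤ.+-identityʳ x))

  mod⇒∣ : ∀ {x} → x ≡ 0ℤ [mod d ] → d ∣ℤ x
  mod⇒∣ {x} (mod p) = subst (d ∣ℤ_) (ℤ.+-identityʳ x) p

-- The quotient by d as a setoid on ℤ, so that integer identities pass to the quotient without a
-- choice of representatives.
ℤ-mod : ℤ → CommutativeRing 0ℓ 0ℓ
ℤ-mod d = record
  { Carrier = ℤ
  ; _≈_ = λ x y → x ≡ y [mod d ]
  ; _+_ = _+_
  ; _*_ = _*_
  ; -_ = -_
  ; 0# = 0ℤ
  ; 1# = 1ℤ
  ; isCommutativeRing = record
    { isRing = record
      { +-isAbelianGroup = record
        { isGroup = record
          { isMonoid = record
            { isSemigroup = record
              { isMagma = record
                { isEquivalence = record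
                  { refl = mod-refl ; sym = mod-sym ; trans = mod-trans }
                ; ∙-cong = mod-+
                }
              ; assoc = λ x y z → mod-reflexive (ℤ.+-assoc x y z)
              }
            ; identity = (λ x → mod-reflexive (ℤ.+-identityˡ x))
                       , (λ x → mod-reflexive (ℤ.+-identityʳ x))
            }
          ; inverse = (λ x → mod-reflexive (ℤ.+-inverseˡ x))
                    , (λ x → mod-reflexive (ℤ.+-inverseʳ x))
          ; ⁻¹-cong = mod-neg
          }
        ; comm = λ x y → mod-reflexive (ℤ.+-comm x y)
        }
      ; *-cong = mod-*
      ; *-assoc = λ x y z → mod-reflexive (ℤ.*-assoc x y z)
      ; *-identity = (λ x → mod-reflexive (ℤ.*-identityˡ x))
                   , (λ x → mod-reflexive (ℤ.*-identityʳ x))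
      ; distrib = (λ x y z → mod-reflexive (ℤ.*-distribˡ-+ x y z))
                , (λ x y z → mod-reflexive (ℤ.*-distribʳ-+ x y z))
      }
    ; *-comm = λ x y → mod-reflexive (ℤ.*-comm x y)
    }
  }

module _ {d : ℤ} where

  open Algebra.Properties.Semiring.Sum (CommutativeRing.semiring (ℤ-mod d)) public
    using () renaming (sum-cong-≋ to sumℤ-mod)

sumℤ-mod-0 : (t : Fin k → ℤ) → (∀ l → t l ≡ 0ℤ [mod d ]) → sumℤ t ≡ 0ℤ [mod d ]
sumℤ-mod-0 {zero}  t t≡0 = mod-refl
sumℤ-mod-0 {suc k} t t≡0 = mod-+ (t≡0 zero) (sumℤ-mod-0 (t ∘ suc) (t≡0 ∘ suc))

sumℤ-↑ : ∀ k (t : Fin (k ℕ.+ l) → ℤ) → sumℤ t ≡ sumℤ (t ∘ (_↑ˡ l)) + sumℤ (t ∘ (k ↑ʳ_))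
sumℤ-↑ zero    t = sym (ℤ.+-identityˡ _)
sumℤ-↑ (suc k) t = trans (cong (λ z → t zero + z) (sumℤ-↑ k (t ∘ suc))) (sym (ℤ.+-assoc (t zero) _ _))

mod-cancelˡ : ∀ {x y} → x + y ≡ 0ℤ [mod d ] → x ≡ 0ℤ [mod d ] → y ≡ 0ℤ [mod d ]
mod-cancelˡ p q = ∣⇒mod (∣m+n∣m⇒∣n (mod⇒∣ p) (mod⇒∣ q))

mod-cancelʳ : ∀ {x y} → x + y ≡ 0ℤ [mod d ] → y ≡ 0ℤ [mod d ] → x ≡ 0ℤ [mod d ]
mod-cancelʳ p q = ∣⇒mod (∣m+n∣n⇒∣m (mod⇒∣ p) (mod⇒∣ q))

double≡0 : ∀ x → x + x ≡ 0ℤ [mod + 2 ]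
double≡0 x = ∣⇒mod (divides x (lemma x))
  where
  lemma : ∀ x → x + x ≡ x * + 2
  lemma = solve-∀

+-double : ∀ x y → x + y + y ≡ x [mod + 2 ]
+-double x y = mod-trans (mod-reflexive (ℤ.+-assoc x y y))
  (mod-trans (mod-+ (mod-refl {x = x}) (double≡0 y)) (mod-reflexive (ℤ.+-identityʳ x)))

-- Sums over the cube

not-≢ : ∀ b → b ≢ not b
not-≢ b = Bool.not-¬ refl

lookup-injective : (u v : CubeVertex n) → (∀ k → lookup u k ≡ lookup v k) → u ≡ v
lookup-injective u v eq =
  trans (sym (Vec.tabulate∘lookup u)) (trans (Vec.tabulate-cong eq) (Vec.tabulate∘lookup v))

adjacent-tail : ∀ b {u v : CubeVertex n} → CubeAdjacent (b ∷ u) (b ∷ v) → CubeAdjacent u v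
adjacent-tail b (zero  , b≢b , _)      = contradiction refl b≢b
adjacent-tail b (suc k , u≢v , unique) = k , u≢v , λ p → Fin.suc-injective (unique p)

adjacent-∷ : ∀ b {u v : CubeVertex n} → CubeAdjacent u v → CubeAdjacent (b ∷ u) (b ∷ v)
adjacent-∷ b (k , u≢v , unique) = suc k , u≢v , λ
  { {zero}  b≢b → contradiction refl b≢b
  ; {suc j} p   → cong suc (unique p)
  }

adjacent-flip : ∀ b (u : CubeVertex n) → CubeAdjacent (b ∷ u) (not b ∷ u)
adjacent-flip b u = zero , not-≢ b , λ
  { {zero}  _   → refl
  ; {suc j} u≢u → contradiction refl u≢u
  }

-- The heads already differ, so by uniqueness the tails differ nowhere.
adjacent-flip⁻¹ : ∀ b {u v : CubeVertex n} → CubeAdjacent (b ∷ u) (not b ∷ v) → v ≡ u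
adjacent-flip⁻¹ b {u} {v} (k , _ , unique) = lookup-injective v u λ j →
  decidable-stable (lookup v j Bool.≟ lookup u j) λ v≢u →
    Fin.0≢1+n (trans (sym (unique {zero} (not-≢ b))) (unique {suc j} (v≢u ∘ sym)))

adjacent-empty : ¬ CubeAdjacent [] []
adjacent-empty (() , _)

module Ordering {k n} (ordering : Fin k ⤖ CubeVertex n) where

  open Bijection ordering public using (to; injective; surjective)

  from : CubeVertex n → Fin k
  from u = proj₁ (surjective u)

  to-from : ∀ u → to (from u) ≡ u
  to-from u = proj₂ (surjective u) refl

  from-to : ∀ j → from (to j) ≡ j
  from-to j = injective (to-from (to j))

module CubeSums {c ℓ} (M : CommutativeMonoid c ℓ) where

  open CommutativeMonoid M using (Carrier; ε; setoid; ∙-cong; ∙-congˡ; identityˡ; identityʳ; comm; reflexive)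
    renaming (_∙_ to _⊞_; _≈_ to _≃_; refl to ≃-refl; sym to ≃-sym; trans to ≃-trans)
  open Algebra.Properties.CommutativeMonoid.Sum M
  open Relation.Binary.Reasoning.Setoid setoid

  -- On coefficients of polynomials with xᵢ² = 1 this is the multiplication by x₁ + ... + xₙ: the
  -- factor xᵢ flips the i-th exponent.
  neighbourSum : (CubeVertex n → Carrier) → CubeVertex n → Carrier
  neighbourSum f []      = ε
  neighbourSum f (b ∷ u) = f (not b ∷ u) ⊞ neighbourSum (λ v → f (b ∷ v)) u

  cubeSum : (CubeVertex n → Carrier) → Carrier
  cubeSum {zero}  f = f []
  cubeSum {suc n} f = cubeSum (λ u → f (false ∷ u)) ⊞ cubeSum (λ u → f (true ∷ u))

  sum-ε : ∀ {k} (t : Fin k → Carrier) → (∀ j → t j ≃ ε) → sum t ≃ ε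
  sum-ε {k} t t≃ε = ≃-trans (sum-cong-≋ t≃ε) (sum-replicate-zero k)

  sum-single : ∀ {k} (i : Fin k) (t : Fin k → Carrier) → (∀ j → j ≢ i → t j ≃ ε) → sum t ≃ t i
  sum-single zero    t t≃ε = ≃-trans (∙-congˡ (sum-ε _ (λ j → t≃ε (suc j) λ ()))) (identityʳ _)
  sum-single (suc i) t t≃ε = ≃-trans
    (∙-cong (t≃ε zero λ ()) (sum-single i (λ j → t (suc j)) (λ j j≢i → t≃ε (suc j) (j≢i ∘ Fin.suc-injective))))
    (identityˡ _)

  cubeSum-cong : {f g : CubeVertex n → Carrier} → (∀ u → f u ≃ g u) → cubeSum f ≃ cubeSum g
  cubeSum-cong {zero}  f≃g = f≃g []
  cubeSum-cong {suc n} f≃g = ∙-cong (cubeSum-cong (λ u → f≃g (false ∷ u))) (cubeSum-cong (λ u → f≃g (true ∷ u)))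

  cubeSum-ε : (t : CubeVertex n → Carrier) → (∀ u → t u ≃ ε) → cubeSum t ≃ ε
  cubeSum-ε {zero}  t t≃ε = t≃ε []
  cubeSum-ε {suc n} t t≃ε = ≃-trans
    (∙-cong (cubeSum-ε _ (λ u → t≃ε (false ∷ u))) (cubeSum-ε _ (λ u → t≃ε (true ∷ u)))) (identityˡ ε)

  cubeSum-single : (u : CubeVertex n) (t : CubeVertex n → Carrier) →
                   (∀ v → v ≢ u → t v ≃ ε) → cubeSum t ≃ t u
  cubeSum-single []          t t≃ε = ≃-refl
  cubeSum-single (false ∷ u) t t≃ε = ≃-trans
    (∙-cong (cubeSum-single u (λ v → t (false ∷ v)) (λ v v≢u → t≃ε (false ∷ v) (v≢u ∘ Vec.∷-injectiveʳ)))
            (cubeSum-ε _ (λ v → t≃ε (true ∷ v) λ ())))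
    (identityʳ _)
  cubeSum-single (true ∷ u)  t t≃ε = ≃-trans
    (∙-cong (cubeSum-ε _ (λ v → t≃ε (false ∷ v) λ ()))
            (cubeSum-single u (λ v → t (true ∷ v)) (λ v v≢u → t≃ε (true ∷ v) (v≢u ∘ Vec.∷-injectiveʳ))))
    (identityˡ _)

  cubeSum-sum : ∀ {k} (t : Fin k → CubeVertex n → Carrier) →
                sum (λ j → cubeSum (t j)) ≃ cubeSum (λ u → sum (λ j → t j u))
  cubeSum-sum {zero}  t = ≃-refl
  cubeSum-sum {suc n} t = ≃-trans (∑-distrib-+ (λ j → cubeSum (λ u → t j (false ∷ u))) _)
    (∙-cong (cubeSum-sum (λ j u → t j (false ∷ u))) (cubeSum-sum (λ j u → t j (true ∷ u))))

  -- The half of the cube with the same head reduces to the neighbours of the tail, and the other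
  -- half contains a single neighbour.
  cubeSum-neighbours : (u : CubeVertex n) (t f : CubeVertex n → Carrier) →
    (∀ v → CubeAdjacent u v → t v ≃ f v) → (∀ v → ¬ CubeAdjacent u v → t v ≃ ε) →
    cubeSum t ≃ neighbourSum f u
  cubeSum-neighbours []          t f t≃f t≃ε = t≃ε [] adjacent-empty
  cubeSum-neighbours (false ∷ u) t f t≃f t≃ε = ≃-trans (∙-cong
    (cubeSum-neighbours u (λ v → t (false ∷ v)) (λ v → f (false ∷ v))
      (λ v adj → t≃f (false ∷ v) (adjacent-∷ false adj))
      (λ v ¬adj → t≃ε (false ∷ v) (¬adj ∘ adjacent-tail false)))
    (≃-trans (cubeSum-single u (λ v → t (true ∷ v)) (λ v v≢u → t≃ε (true ∷ v) (v≢u ∘ adjacent-flip⁻¹ false)))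
           (t≃f (true ∷ u) (adjacent-flip false u))))
    (comm _ _)
  cubeSum-neighbours (true ∷ u)  t f t≃f t≃ε = ∙-cong
    (≃-trans (cubeSum-single u (λ v → t (false ∷ v)) (λ v v≢u → t≃ε (false ∷ v) (v≢u ∘ adjacent-flip⁻¹ true)))
           (t≃f (false ∷ u) (adjacent-flip true u)))
    (cubeSum-neighbours u (λ v → t (true ∷ v)) (λ v → f (true ∷ v))
      (λ v adj → t≃f (true ∷ v) (adjacent-∷ true adj))
      (λ v ¬adj → t≃ε (true ∷ v) (¬adj ∘ adjacent-tail true)))

  module _ {k} (ordering : Fin k ⤖ CubeVertex n) where

    open Ordering ordering

    -- Double counting: `restricted` carries the values of f on the graph of the bijection and ε
    -- elsewhere, and summing it in either order gives the two sides.
    sum-ordering : (f : CubeVertex n → Carrier) → sum (λ j → f (to j)) ≃ cubeSum f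
    sum-ordering f = begin
      sum (λ j → f (to j))                      ≈⟨ sum-cong-≋ (λ j → ≃-sym (column j)) ⟩
      sum (λ j → cubeSum (λ u → restricted j u)) ≈⟨ cubeSum-sum restricted ⟩
      cubeSum (λ u → sum (λ j → restricted j u)) ≈⟨ cubeSum-cong row ⟩
      cubeSum f ∎
      where
      restricted : Fin k → CubeVertex n → Carrier
      restricted j u = if does (from u Fin.≟ j) then f u else ε

      on : ∀ u j → from u ≡ j → restricted j u ≃ f u
      on u j eq = reflexive (cong (if_then f u else ε) (dec-true (from u Fin.≟ j) eq))

      off : ∀ u j → from u ≢ j → restricted j u ≃ ε
      off u j neq = reflexive (cong (if_then f u else ε) (dec-false (from u Fin.≟ j) neq))

      column : ∀ j → cubeSum (restricted j) ≃ f (to j)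
      column j = ≃-trans
        (cubeSum-single (to j) (restricted j) (λ u u≢ → off u j (λ eq → u≢ (trans (sym (to-from u)) (cong to eq)))))
        (on (to j) j (from-to j))

      row : ∀ u → sum (λ j → restricted j u) ≃ f u
      row u = ≃-trans
        (sum-single (from u) (λ j → restricted j u) (λ j j≢ → off u j (j≢ ∘ sym)))
        (on u (from u) refl)

    sum-neighbours : ∀ i (s : Fin k → Carrier) (f : CubeVertex n → Carrier) →
      (∀ j → CubeAdjacent (to i) (to j) → s j ≃ f (to j)) →
      (∀ j → ¬ CubeAdjacent (to i) (to j) → s j ≃ ε) →
      sum s ≃ neighbourSum f (to i)
    sum-neighbours i s f s≃f s≃ε = begin
      sum s                         ≈⟨ sum-cong-≋ (λ j → reflexive (cong s (sym (from-to j)))) ⟩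
      sum (λ j → s (from (to j)))   ≈⟨ sum-ordering (λ v → s (from v)) ⟩
      cubeSum (λ v → s (from v))    ≈⟨ cubeSum-neighbours (to i) (λ v → s (from v)) f
        (λ v adj → ≃-trans (s≃f (from v) (subst (CubeAdjacent (to i)) (sym (to-from v)) adj))
                         (reflexive (cong f (to-from v))))
        (λ v ¬adj → s≃ε (from v) (¬adj ∘ subst (CubeAdjacent (to i)) (to-from v))) ⟩
      neighbourSum f (to i)         ∎

open CubeSums ℤ.+-0-commutativeMonoid

neighbourSum-cong : {f g : CubeVertex n → ℤ} → (∀ u → f u ≡ g u) →
                    ∀ u → neighbourSum f u ≡ neighbourSum g u
neighbourSum-cong f≡g []      = refl
neighbourSum-cong f≡g (b ∷ u) = cong₂ _+_ (f≡g _) (neighbourSum-cong (λ v → f≡g (b ∷ v)) u)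

neighbourSum-linear : ∀ a b (f g : CubeVertex n → ℤ) u →
  neighbourSum (λ v → a * f v + b * g v) u ≡ a * neighbourSum f u + b * neighbourSum g u
neighbourSum-linear a b f g []      = lemma a b
  where
  lemma : ∀ a b → 0ℤ ≡ a * 0ℤ + b * 0ℤ
  lemma = solve-∀
neighbourSum-linear a b f g (x ∷ u) = trans
  (cong (λ z → a * f (not x ∷ u) + b * g (not x ∷ u) + z)
        (neighbourSum-linear a b (λ v → f (x ∷ v)) (λ v → g (x ∷ v)) u))
  (lemma a b _ _ _ _)
  where
  lemma : ∀ a b p q r s → (a * p + b * q) + (a * r + b * s) ≡ a * (p + r) + b * (q + s)
  lemma = solve-∀

neighbourSum-+ : ∀ (f g : CubeVertex n → ℤ) u →
  neighbourSum (λ v → f v + g v) u ≡ neighbourSum f u + neighbourSum g u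
neighbourSum-+ f g u = trans
  (neighbourSum-cong (λ v → lemma (f v) (g v)) u)
  (trans (neighbourSum-linear 1ℤ 1ℤ f g u) (sym (lemma (neighbourSum f u) (neighbourSum g u))))
  where
  lemma : ∀ x y → x + y ≡ 1ℤ * x + 1ℤ * y
  lemma = solve-∀

neighbourSum-* : ∀ a (f : CubeVertex n → ℤ) u →
  neighbourSum (λ v → a * f v) u ≡ a * neighbourSum f u
neighbourSum-* a f u = trans
  (neighbourSum-cong (λ v → lemma a (f v)) u)
  (trans (neighbourSum-linear a 0ℤ f f u) (sym (lemma a (neighbourSum f u))))
  where
  lemma : ∀ a x → a * x ≡ a * x + 0ℤ * x
  lemma = solve-∀

neighbourSum-0 : ∀ (u : CubeVertex n) → neighbourSum (λ _ → 0ℤ) u ≡ 0ℤ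
neighbourSum-0 u = neighbourSum-* 0ℤ (λ _ → 0ℤ) u

infixl 6 _⊕_
-- The product of monomials, since xᵢ² = 1.
_⊕_ : CubeVertex n → CubeVertex n → CubeVertex n
_⊕_ = zipWith _xor_

not-xor : ∀ b c → not b xor c ≡ not (b xor c)
not-xor false c = refl
not-xor true  c = sym (Bool.not-involutive c)

neighbourSum-translate : ∀ (f : CubeVertex n → ℤ) s u →
  neighbourSum (λ v → f (v ⊕ s)) u ≡ neighbourSum f (u ⊕ s)
neighbourSum-translate f []      []      = refl
neighbourSum-translate f (c ∷ s) (b ∷ u) = cong₂ _+_
  (cong (λ a → f (a ∷ u ⊕ s)) (not-xor b c))
  (neighbourSum-translate (λ v → f ((b xor c) ∷ v)) s u)

-- Elementary symmetric polynomials

-- The coefficients of eₖ on the monomials, u being the set of the indices i with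
-- uᵢ = true.
elementary : ℕ → CubeVertex n → ℤ
elementary zero    []          = 1ℤ
elementary (suc k) []          = 0ℤ
elementary zero    (false ∷ u) = elementary zero u
elementary (suc k) (false ∷ u) = elementary (suc k) u + elementary k u
elementary zero    (true ∷ u)  = 0ℤ
elementary (suc k) (true ∷ u)  = elementary k u

-- With yᵢ = 1 + xᵢ, the square of yᵢ is 2yᵢ. Hence e₁eₖ = (k + 1)eₖ₊₁ + 2keₖ, and the sum of the xᵢ
-- is e₁ - n.
neighbourSum-elementary : ∀ k (u : CubeVertex n) →
  neighbourSum (elementary k) u ≡ + suc k * elementary (suc k) u + (+ 2 * + k - + n) * elementary k u
neighbourSum-elementary zero    [] = refl
neighbourSum-elementary (suc k) [] = lemma (+ suc (suc k)) (+ 2 * + suc k - 0ℤ)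
  where
  lemma : ∀ a b → 0ℤ ≡ a * 0ℤ + b * 0ℤ
  lemma = solve-∀
neighbourSum-elementary {suc n} zero (true ∷ u) =
  trans (cong (λ z → elementary zero u + z) (neighbourSum-0 u)) (lemma (elementary zero u) (- (+ suc n)))
  where
  lemma : ∀ x y → x + 0ℤ ≡ 1ℤ * x + (0ℤ + y) * 0ℤ
  lemma = solve-∀
neighbourSum-elementary {suc n} (suc k) (true ∷ u) =
  trans (cong (λ z → elementary (suc k) u + elementary k u + z) (neighbourSum-elementary k u))
        (lemma (+ k) (+ n) (elementary (suc k) u) (elementary k u))
  where
  lemma : ∀ k n x y → x + y + ((1ℤ + k) * x + (+ 2 * k - n) * y) ≡
                      (1ℤ + (1ℤ + k)) * x + (+ 2 * (1ℤ + k) - (1ℤ + n)) * y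
  lemma = solve-∀
neighbourSum-elementary {suc n} zero (false ∷ u) =
  trans (cong (λ z → 0ℤ + z) (neighbourSum-elementary zero u)) (lemma (+ n) (elementary 1 u) (elementary zero u))
  where
  lemma : ∀ n x y → 0ℤ + (1ℤ * x + (0ℤ - n) * y) ≡ 1ℤ * (x + y) + (0ℤ - (1ℤ + n)) * y
  lemma = solve-∀
neighbourSum-elementary {suc n} (suc k) (false ∷ u) =
  trans (cong (λ z → elementary k u + z) (trans (neighbourSum-+ (elementary (suc k)) (elementary k) u)
                                (cong₂ _+_ (neighbourSum-elementary (suc k) u) (neighbourSum-elementary k u))))
        (lemma (+ k) (+ n) (elementary (suc (suc k)) u) (elementary (suc k) u) (elementary k u))
  where
  lemma : ∀ k n x y z →
    z + (((1ℤ + (1ℤ + k)) * x + (+ 2 * (1ℤ + k) - n) * y) + ((1ℤ + k) * y + (+ 2 * k - n) * z)) ≡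
    (1ℤ + (1ℤ + k)) * (x + y) + (+ 2 * (1ℤ + k) - (1ℤ + n)) * (y + z)
  lemma = solve-∀

-- The generating function is that of elementary divided by (1 + 2t)ʳ: this is cₖ
-- for n = 2r.
centred : ℕ → ℕ → CubeVertex n → ℤ
centred zero    k       u = elementary k u
centred (suc r) zero    u = centred r zero u
centred (suc r) (suc k) u = 1ℤ * centred r (suc k) u + - (+ 2) * centred (suc r) k u

-- The generating function F satisfies s F = (1 + 2t) F′ + (2r - n) F, as each division by 1 + 2t
-- adds 2F on the right.
neighbourSum-centred : ∀ r k (u : CubeVertex n) →
  neighbourSum (centred r k) u ≡ + suc k * centred r (suc k) u + (+ 2 * + k - + n + + 2 * + r) * centred r k u
neighbourSum-centred {n} zero k u = trans (neighbourSum-elementary k u)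
  (cong (λ z → + suc k * elementary (suc k) u + z * elementary k u) (sym (ℤ.+-identityʳ (+ 2 * + k - + n))))
neighbourSum-centred {n} (suc r) zero u =
  trans (neighbourSum-centred r zero u) (lemma (+ n) (+ r) (centred r 1 u) (centred r 0 u))
  where
  lemma : ∀ n r x y → 1ℤ * x + (0ℤ - n + + 2 * r) * y ≡
                      1ℤ * (1ℤ * x + - (+ 2) * y) + (0ℤ - n + + 2 * (1ℤ + r)) * y
  lemma = solve-∀
neighbourSum-centred {n} (suc r) (suc k) u =
  trans (neighbourSum-linear 1ℤ (- (+ 2)) (centred r (suc k)) (centred (suc r) k) u)
 (trans (cong₂ (λ x y → 1ℤ * x + - (+ 2) * y) (neighbourSum-centred r (suc k) u) (neighbourSum-centred (suc r) k u))
        (lemma (+ n) (+ r) (+ k) (centred r (suc (suc k)) u) (centred r (suc k) u) (centred (suc r) k u)))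
  where
  lemma : ∀ n r k x y z →
    1ℤ * ((1ℤ + (1ℤ + k)) * x + (+ 2 * (1ℤ + k) - n + + 2 * r) * y) +
    - (+ 2) * ((1ℤ + k) * (1ℤ * y + - (+ 2) * z) + (+ 2 * k - n + + 2 * (1ℤ + r)) * z) ≡
    (1ℤ + (1ℤ + k)) * (1ℤ * x + - (+ 2) * (1ℤ * y + - (+ 2) * z)) +
    (+ 2 * (1ℤ + k) - n + + 2 * (1ℤ + r)) * (1ℤ * y + - (+ 2) * z)
  lemma = solve-∀

subtractTwice : ∀ {x y} z → x ≡ y [mod + 2 ] → 1ℤ * x + - (+ 2) * z ≡ y [mod + 2 ]
subtractTwice {x} {y} z (mod p) =
  mod (subst (+ 2 ∣ℤ_) (lemma x y z) (∣m∣n⇒∣m-n p (∣m⇒∣m*n z ∣-refl)))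
  where
  lemma : ∀ x y z → x - y - + 2 * z ≡ 1ℤ * x + - (+ 2) * z - y
  lemma = solve-∀

-- The denominator (1 + 2t)ʳ is 1 modulo 2.
centred≡elementary : ∀ r k (u : CubeVertex n) → centred r k u ≡ elementary k u [mod + 2 ]
centred≡elementary zero    k       u = mod-refl
centred≡elementary (suc r) zero    u = centred≡elementary r zero u
centred≡elementary (suc r) (suc k) u = subtractTwice _ (centred≡elementary r (suc k) u)

-- This is pₖ, whose generating function is t / (1 + 2t) times that of `centred`. The factor 1ℤ
-- matches the shape of `neighbourSum-linear`.
potential : ℕ → ℕ → CubeVertex n → ℤ
potential r zero    u = 0ℤ
potential r (suc k) u = 1ℤ * centred r k u + - (+ 2) * potential r k u

potential≡elementary : ∀ r k (u : CubeVertex n) → potential r (suc k) u ≡ elementary k u [mod + 2 ]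
potential≡elementary r k u = subtractTwice _ (centred≡elementary r k u)

-- For n = 2r the term 2k cₖ of s cₖ cancels against -2 s pₖ.
neighbourSum-potential : ∀ {r} k → n ≡ 2 ℕ.* r → (u : CubeVertex n) →
                 neighbourSum (potential r k) u ≡ + k * centred r k u
neighbourSum-potential zero eq u = neighbourSum-0 u
neighbourSum-potential {n} {r} (suc k) eq u =
  trans (neighbourSum-linear 1ℤ (- (+ 2)) (centred r k) (potential r k) u)
 (trans (cong₂ (λ x y → 1ℤ * x + - (+ 2) * y) (neighbourSum-centred r k u) (neighbourSum-potential k eq u))
 (trans (cong (λ z → 1ℤ * (+ suc k * centred r (suc k) u + (+ 2 * + k - z + + 2 * + r) * centred r k u)
                     + - (+ 2) * (+ k * centred r k u)) (trans (cong (λ m → + m) eq) (ℤ.pos-* 2 r)))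
        (lemma (+ r) (+ k) (centred r (suc k) u) (centred r k u))))
  where
  lemma : ∀ r k x y → 1ℤ * ((1ℤ + k) * x + (+ 2 * k - + 2 * r + + 2 * r) * y) + - (+ 2) * (k * y)
                      ≡ (1ℤ + k) * x
  lemma = solve-∀

-- Families of functions independent modulo 2

CubeFunction : ℕ → Set
CubeFunction n = CubeVertex n → ℤ

Independent : (Fin k → CubeFunction n) → Set
Independent {k} f = ∀ (c : Fin k → ℤ) →
  (∀ u → sumℤ (λ l → c l * f l u) ≡ 0ℤ [mod + 2 ]) → ∀ l → c l ≡ 0ℤ [mod + 2 ]

-- A witness that the functions with property P span at least k dimensions modulo 2.
record Family (P : CubeFunction n → Set) (k : ℕ) : Set where
  field
    element      : Fin k → CubeFunction n
    property     : ∀ l → P (element l)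
    independence : Independent element

open Family

emptyFamily : {P : CubeFunction n → Set} → Family P 0
emptyFamily = record { element = λ () ; property = λ () ; independence = λ _ _ () }

mapFamily : {P Q : CubeFunction n → Set} → (∀ {g} → P g → Q g) → Family P k → Family Q k
mapFamily P⊆Q G = record
  { element = element G ; property = P⊆Q ∘ property G ; independence = independence G }

branch : CubeFunction n → CubeFunction n → CubeFunction (suc n)
branch f g (false ∷ u) = f u
branch f g (true ∷ u)  = g u

0ᶠ : CubeFunction n
0ᶠ _ = 0ℤ

-- The coefficients of x₁ determine the scalars on the second family, hence the
-- functions f do not matter.
joinFamilies : {P₀ P₁ : CubeFunction n → Set} {P : CubeFunction (suc n) → Set} →
  (∀ {g} → P₀ g → P (branch g 0ᶠ)) → (∀ {g} → P₁ g → ∃[ f ] P (branch f g)) →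
  Family P₀ k → Family P₁ l → Family P (k ℕ.+ l)
joinFamilies {n} {k} {l} {P = P} lower upper G₀ G₁ = record
  { element      = b
  ; property     = property′
  ; independence = independent′
  }
  where
  b₀ : Fin k → CubeFunction (suc n)
  b₀ i = branch (element G₀ i) 0ᶠ

  f₁ : Fin l → CubeFunction n
  f₁ j = proj₁ (upper (property G₁ j))

  b₁ : Fin l → CubeFunction (suc n)
  b₁ j = branch (f₁ j) (element G₁ j)

  b : Fin (k ℕ.+ l) → CubeFunction (suc n)
  b = b₀ Functional.++ b₁

  property′ : ∀ i → P (b i)
  property′ i with splitAt k i
  ... | inj₁ i₀ = lower (property G₀ i₀)
  ... | inj₂ i₁ = proj₂ (upper (property G₁ i₁))

  split : ∀ (c : Fin (k ℕ.+ l) → ℤ) → (∀ u → sumℤ (λ i → c i * b i u) ≡ 0ℤ [mod + 2 ]) → ∀ u →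
          sumℤ (λ i → c (i ↑ˡ l) * b₀ i u) + sumℤ (λ j → c (k ↑ʳ j) * b₁ j u) ≡ 0ℤ [mod + 2 ]
  split c Σ≡0 u = mod-trans (mod-reflexive (sym (trans (sumℤ-↑ k (λ i → c i * b i u)) (cong₂ _+_
    (sumℤ-cong (λ i → cong (λ f → c (i ↑ˡ l) * f u) (Functional.lookup-++ˡ b₀ b₁ i)))
    (sumℤ-cong (λ j → cong (λ f → c (k ↑ʳ j) * f u) (Functional.lookup-++ʳ b₀ b₁ j))))))) (Σ≡0 u)

  module _ (c : Fin (k ℕ.+ l) → ℤ) (Σ≡0 : ∀ u → sumℤ (λ i → c i * b i u) ≡ 0ℤ [mod + 2 ]) where

    c₁≡0 : ∀ j → c (k ↑ʳ j) ≡ 0ℤ [mod + 2 ]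
    c₁≡0 = independence G₁ _ λ u → mod-cancelˡ (split c Σ≡0 (true ∷ u))
      (sumℤ-mod-0 _ (λ j → mod-reflexive (ℤ.*-zeroʳ (c (j ↑ˡ l)))))

    c₀≡0 : ∀ i → c (i ↑ˡ l) ≡ 0ℤ [mod + 2 ]
    c₀≡0 = independence G₀ _ λ u → mod-cancelʳ (split c Σ≡0 (false ∷ u))
      (sumℤ-mod-0 _ (λ j → mod-* {y = 0ℤ} (c₁≡0 j) (mod-refl {x = f₁ j u})))

  independent′ : Independent b
  independent′ c Σ≡0 i with splitAt k i in eq
  ... | inj₁ i₀ = subst (λ i → c i ≡ 0ℤ [mod + 2 ]) (Fin.splitAt⁻¹-↑ˡ eq) (c₀≡0 c Σ≡0 i₀)
  ... | inj₂ i₁ = subst (λ i → c i ≡ 0ℤ [mod + 2 ]) (Fin.splitAt⁻¹-↑ʳ eq) (c₁≡0 c Σ≡0 i₁)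

-- `elementary 0` is e₀ = 1, the indicator of the empty set, and its translates are the monomials.
-- In this form they are also generators of the ideal below.
IsMonomial : CubeFunction n → Set
IsMonomial {n} g = ∃[ s ] (∀ u → g u ≡ elementary 0 (u ⊕ s) [mod + 2 ])

monomials : ∀ n → Family (IsMonomial {n}) (2 ^ n)
monomials zero = record
  { element     = λ _ _ → 1ℤ
  ; property    = λ _ → [] , λ { [] → mod-refl }
  ; independence = λ { c Σ≡0 zero → mod-trans (mod-reflexive (lemma (c zero))) (Σ≡0 []) }
  }
  where
  lemma : ∀ x → x ≡ x * 1ℤ + 0ℤ
  lemma = solve-∀
monomials (suc n) = subst (Family IsMonomial) (cong (2 ^ n ℕ.+_) (sym (ℕ.+-identityʳ (2 ^ n))))
  (joinFamilies
    (λ { (s , g≡s) → false ∷ s , λ { (false ∷ u) → g≡s u ; (true ∷ u) → mod-refl } })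
    (λ { (s , g≡s) → 0ᶠ , true ∷ s , λ { (false ∷ u) → mod-refl ; (true ∷ u) → g≡s u } })
    (monomials n) (monomials n))

-- Good and bad lattice paths

private variable
  f g : CubeFunction n

-- Among the paths of n steps ±1 starting at a, the bad ones reach −1 before a + b.
goodPaths : ℕ → ℕ → ℕ → ℕ
goodPaths n       a       zero    = 2 ^ n
goodPaths zero    a       (suc b) = 1
goodPaths (suc n) zero    (suc b) = goodPaths n 1 b
goodPaths (suc n) (suc a) (suc b) = goodPaths n a (2 ℕ.+ b) ℕ.+ goodPaths n (2 ℕ.+ a) b

badPaths : ℕ → ℕ → ℕ → ℕ
badPaths n       a       zero    = 0
badPaths zero    a       (suc b) = 0
-- A step down from 0 reaches -1, so all 2ⁿ continuations are bad. Unlike in `goodPaths`, the step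
-- up comes first: in `idealFamily` it keeps x₁ out of the leading monomial.
badPaths (suc n) zero    (suc b) = badPaths n 1 b ℕ.+ 2 ^ n
badPaths (suc n) (suc a) (suc b) = badPaths n (2 ℕ.+ a) b ℕ.+ badPaths n a (2 ℕ.+ b)

goodPaths+badPaths : ∀ n a b → goodPaths n a b ℕ.+ badPaths n a b ≡ 2 ^ n
goodPaths+badPaths n       a       zero    = ℕ.+-identityʳ (2 ^ n)
goodPaths+badPaths zero    a       (suc b) = refl
goodPaths+badPaths (suc n) zero    (suc b) = trans
  (sym (ℕ.+-assoc (goodPaths n 1 b) _ (2 ^ n)))
  (cong₂ ℕ._+_ (goodPaths+badPaths n 1 b) (sym (ℕ.+-identityʳ (2 ^ n))))
goodPaths+badPaths (suc n) (suc a) (suc b) = trans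
  (lemma (goodPaths n a (2 ℕ.+ b)) _ _ (badPaths n a (2 ℕ.+ b)))
  (cong₂ ℕ._+_ (goodPaths+badPaths n a (2 ℕ.+ b))
    (trans (goodPaths+badPaths n (2 ℕ.+ a) b) (sym (ℕ.+-identityʳ (2 ^ n)))))
  where
  lemma : ∀ x y z w → x ℕ.+ y ℕ.+ (z ℕ.+ w) ≡ x ℕ.+ w ℕ.+ (y ℕ.+ z)
  lemma = solveℕ-∀

-- Functions annihilated modulo a power of 2

neighbourSum-++ : ∀ {m n} (f : CubeFunction (m ℕ.+ n)) (p : CubeVertex m) (u : CubeVertex n) →
  neighbourSum f (p Vec.++ u) ≡ neighbourSum (λ q → f (q Vec.++ u)) p + neighbourSum (λ v → f (p Vec.++ v)) u
neighbourSum-++ f []      u = sym (ℤ.+-identityˡ _)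
neighbourSum-++ f (b ∷ p) u = trans
  (cong (λ z → f (not b ∷ p Vec.++ u) + z) (neighbourSum-++ (λ v → f (b ∷ v)) p u))
  (sym (ℤ.+-assoc (f (not b ∷ p Vec.++ u)) _ _))

ones : ∀ a → CubeVertex a
ones a = replicate a true

elementary-ones : ∀ a (u : CubeVertex n) → elementary a (ones a Vec.++ u) ≡ elementary 0 u
elementary-ones zero    u = refl
elementary-ones (suc a) u = elementary-ones a u

-- Coefficients of x − y and of x y − 1.
difference product-1 : Bool → Bool → ℤ
difference true  true  = 0ℤ
difference true  false = 1ℤ
difference false true  = -1ℤ
difference false false = 0ℤ
product-1  true  true  = 1ℤ
product-1  true  false = 0ℤ
product-1  false true  = 0ℤ
product-1  false false = -1ℤ

-- (x + y)(x - y) = x² - y² = 0.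
difference-swap : ∀ x y → difference (not x) y + difference x (not y) ≡ 0ℤ
difference-swap true  true  = refl
difference-swap true  false = refl
difference-swap false true  = refl
difference-swap false false = refl

-- (x + y)(x y - 1) = x² y + x y² - x - y = 0, as the squares are 1.
product-1-swap : ∀ x y → product-1 (not x) y + product-1 x (not y) ≡ 0ℤ
product-1-swap true  true  = refl
product-1-swap true  false = refl
product-1-swap false true  = refl
product-1-swap false false = refl

-- The product of x y - 1 over consecutive pairs of variables. In odd length 0 is a default, which
-- is annihilated as well.
pairing : CubeFunction n
pairing []          = 1ℤ
pairing (x ∷ [])    = 0ℤ
pairing (x ∷ y ∷ p) = product-1 x y * pairing p

neighbourSum-pairing : (p : CubeVertex n) → neighbourSum pairing p ≡ 0ℤ
neighbourSum-pairing []          = refl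
neighbourSum-pairing (x ∷ [])    = refl
neighbourSum-pairing (x ∷ y ∷ p) = begin
  product-1 (not x) y * w + (product-1 x (not y) * w + neighbourSum (λ q → product-1 x y * pairing q) p)
    ≡⟨ cong (λ z → product-1 (not x) y * w + (product-1 x (not y) * w + z))
         (trans (neighbourSum-* (product-1 x y) pairing p)
                (cong (product-1 x y *_) (neighbourSum-pairing p))) ⟩
  product-1 (not x) y * w + (product-1 x (not y) * w + product-1 x y * 0ℤ)
    ≡⟨ lemma (product-1 (not x) y) _ w (product-1 x y) ⟩
  (product-1 (not x) y + product-1 x (not y)) * w
    ≡⟨ cong (_* w) (product-1-swap x y) ⟩
  0ℤ ∎
  where
  open ≡-Reasoning
  w = pairing p
  lemma : ∀ p q w r → p * w + (q * w + r * 0ℤ) ≡ (p + q) * w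
  lemma = solve-∀

pairing-ones : ∀ r → pairing (ones (r ℕ.* 2)) ≡ 1ℤ
pairing-ones zero    = refl
pairing-ones (suc r) = trans (ℤ.*-identityˡ _) (pairing-ones r)

2∣-pred² : ∀ a n → 2 ℕ.∣ suc a ℕ.+ suc n → 2 ℕ.∣ a ℕ.+ n
2∣-pred² a n p = ℕ.∣m+n∣m⇒∣n (subst (2 ℕ.∣_) (cong suc (ℕ.+-suc a n)) p) ℕ.∣-refl

module _ (i h : ℕ) (1+h≡2^1+i : suc h ≡ 2 ^ suc i) where

  modulus : ℤ
  modulus = + (2 ^ suc i)

  -- Here g is the coefficient of z₁ ⋯ zₐ in a polynomial W in further variables
  -- z₁, …, zₐ that come before x₁, …, xₙ: they wait for a partner x to form a
  -- factor z − x.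
  record Liftable (a : ℕ) (g : CubeFunction n) : Set where
    field
      W          : CubeVertex a → CubeFunction n
      leading    : ∀ u → W (ones a) u ≡ g u [mod + 2 ]
      annihilate : ∀ p u → neighbourSum (λ q → W q u) p + neighbourSum (W p) u ≡ 0ℤ [mod modulus ]

  open Liftable

  -- The waiting variable z₁ is renamed x₁: g becomes the coefficient of x₁, and f is whatever
  -- remains.
  liftable-upper : Liftable (suc a) g → ∃[ f ] Liftable a (branch f g)
  liftable-upper {a} {g = g} L = (λ u → W L (false ∷ ones a) u) , record
    { W          = λ { p (x ∷ u) → W L (x ∷ p) u }
    ; leading    = λ { (false ∷ u) → mod-refl ; (true ∷ u) → leading L u }
    ; annihilate = λ { p (x ∷ u) → mod-trans
        (mod-reflexive (lemma (neighbourSum (λ q → W L (x ∷ q) u) p) (W L (not x ∷ p) u)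
                              (neighbourSum (W L (x ∷ p)) u)))
        (annihilate L (x ∷ p) u) }
    }
    where
    lemma : ∀ x y z → x + (y + z) ≡ y + x + z
    lemma = solve-∀

  -- W is multiplied by z₁ - x₁, which z₁ + x₁ annihilates. The coefficient of z₁ in this factor is
  -- free of x₁.
  liftable-lower : Liftable a g → Liftable (suc a) (branch g 0ᶠ)
  liftable-lower L = record
    { W          = λ { (x ∷ p) (y ∷ u) → difference x y * W L p u }
    ; leading    = λ { (false ∷ u) → mod-trans (mod-reflexive (ℤ.*-identityˡ _)) (leading L u)
                     ; (true ∷ u)  → mod-refl }
    ; annihilate = λ { (x ∷ p) (y ∷ u) → annihilated x p y u }
    }
    where
    annihilated : ∀ x p y u →
      (difference (not x) y * W L p u + neighbourSum (λ q → difference x y * W L q u) p) +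
      (difference x (not y) * W L p u + neighbourSum (λ v → difference x y * W L p v) u) ≡ 0ℤ [mod modulus ]
    annihilated x p y u = mod-trans (mod-reflexive (begin
      (difference (not x) y * w + neighbourSum (λ q → c * W L q u) p) +
      (difference x (not y) * w + neighbourSum (λ v → c * W L p v) u)
        ≡⟨ cong₂ (λ s t → (difference (not x) y * w + s) + (difference x (not y) * w + t))
             (neighbourSum-* c (λ q → W L q u) p) (neighbourSum-* c (W L p) u) ⟩
      (difference (not x) y * w + c * s) + (difference x (not y) * w + c * t)
        ≡⟨ lemma (difference (not x) y) (difference x (not y)) w c s t ⟩
      (difference (not x) y + difference x (not y)) * w + c * (s + t)
        ≡⟨ cong (λ z → z * w + c * (s + t)) (difference-swap x y) ⟩
      0ℤ + c * (s + t)
        ≡⟨ ℤ.+-identityˡ _ ⟩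
      c * (s + t) ∎))
      (mod-trans (mod-* (mod-refl {x = c}) (annihilate L p u)) (mod-reflexive (ℤ.*-zeroʳ c)))
      where
      open ≡-Reasoning
      w = W L p u
      c = difference x y
      s = neighbourSum (λ q → W L q u) p
      t = neighbourSum (W L p) u
      lemma : ∀ d d′ w c s t → (d * w + c * s) + (d′ * w + c * t) ≡ (d + d′) * w + c * (s + t)
      lemma = solve-∀

  -- W is p_H in all the variables z and x, times the monomial: the sum of the variables sends p_H
  -- to H c_H. Modulo 2, p_H is e_h, where z₁ ⋯ z_h has coefficient 1.
  liftable-top : 2 ℕ.∣ h ℕ.+ n → IsMonomial {n} g → Liftable h g
  liftable-top {n = n} (ℕ.divides r h+n≡r*2) (s , g≡s) = record
    { W          = λ p u → v (p Vec.++ (u ⊕ s))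
    ; leading    = λ u → mod-trans (potential≡elementary r h (ones h Vec.++ (u ⊕ s)))
                        (mod-trans (mod-reflexive (elementary-ones h (u ⊕ s))) (mod-sym (g≡s u)))
    ; annihilate = λ p u → mod-trans (mod-reflexive (begin
        neighbourSum (λ q → v (q Vec.++ (u ⊕ s))) p + neighbourSum (λ u → v (p Vec.++ (u ⊕ s))) u
          ≡⟨ cong (λ z → neighbourSum (λ q → v (q Vec.++ (u ⊕ s))) p + z)
               (neighbourSum-translate (λ u → v (p Vec.++ u)) s u) ⟩
        neighbourSum (λ q → v (q Vec.++ (u ⊕ s))) p + neighbourSum (λ u → v (p Vec.++ u)) (u ⊕ s)
          ≡⟨ neighbourSum-++ v p (u ⊕ s) ⟨
        neighbourSum v (p Vec.++ (u ⊕ s))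
          ≡⟨ neighbourSum-potential {r = r} (suc h) (trans h+n≡r*2 (ℕ.*-comm r 2)) (p Vec.++ (u ⊕ s)) ⟩
        + suc h * centred r (suc h) (p Vec.++ (u ⊕ s))
          ≡⟨ cong (λ H → + H * centred r (suc h) (p Vec.++ (u ⊕ s))) 1+h≡2^1+i ⟩
        modulus * centred r (suc h) (p Vec.++ (u ⊕ s)) ∎))
        (∣⇒mod (∣m⇒∣m*n _ ∣-refl))
    }
    where
    open ≡-Reasoning
    v : CubeFunction (h ℕ.+ n)
    v = potential r (suc h)

  -- No x is left, so the waiting variables are matched among themselves.
  liftable-end : ∀ a → 2 ℕ.∣ a → Family (Liftable {0} a) 1
  liftable-end a (ℕ.divides r refl) = record
    { element     = λ _ _ → 1ℤ
    ; property    = λ _ → record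
      { W          = λ p _ → pairing p
      ; leading    = λ _ → mod-reflexive (pairing-ones r)
      ; annihilate = λ { p [] → mod-reflexive (trans (ℤ.+-identityʳ _) (neighbourSum-pairing p)) }
      }
    ; independence = Family.independence (monomials 0)
    }

  -- The height a is the number of waiting variables: a step up makes x₁ wait and a step down
  -- matches it. At a = h every monomial is allowed.
  liftableFamily : ∀ n a b → a ℕ.+ b ≡ h → 2 ℕ.∣ a ℕ.+ n → Family (Liftable {n} a) (goodPaths n a b)
  liftableFamily n a zero a+b≡h even
    with refl ← trans (sym (ℕ.+-identityʳ a)) a+b≡h = mapFamily (liftable-top even) (monomials n)
  liftableFamily zero a (suc b) a+b≡h even = liftable-end a (subst (2 ℕ.∣_) (ℕ.+-identityʳ a) even)
  liftableFamily (suc n) zero (suc b) a+b≡h even =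
    -- At height 0 there is no waiting variable to match with x₁, so the lower family is empty.
    joinFamilies {P₀ = λ _ → ⊥} (λ ()) liftable-upper emptyFamily (liftableFamily n 1 b a+b≡h even)
  liftableFamily (suc n) (suc a) (suc b) a+b≡h even =
    joinFamilies liftable-lower liftable-upper
      (liftableFamily n a (2 ℕ.+ b) (trans (ℕ.+-suc a (suc b)) a+b≡h) (2∣-pred² a n even))
      (liftableFamily n (2 ℕ.+ a) b (trans (cong suc (sym (ℕ.+-suc a b))) a+b≡h)
        (subst (2 ℕ.∣_) (cong suc (ℕ.+-suc a n)) even))

-- The ideal of elementary symmetric polynomials modulo 2

module _ (H : ℕ) where

  -- The ideal generated by e_a, …, e_{H−1} modulo 2: translation by s is the
  -- multiplication by a monomial.
  data Ideal (a : ℕ) {n} : CubeFunction n → Set where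
    generator : ∀ k s → a ≤ k → k < H → Ideal a (λ u → elementary k (u ⊕ s))
    add       : Ideal a f → Ideal a g → Ideal a (λ u → f u + g u)
    respects  : (∀ u → f u ≡ g u [mod + 2 ]) → Ideal a f → Ideal a g

  -- Substituting 1 for x₁ turns the factor 1 + x₁ into 2.
  elementary-false+true : ∀ k (u : CubeVertex n) →
    elementary k (false ∷ u) + elementary k (true ∷ u) ≡ elementary k u [mod + 2 ]
  elementary-false+true zero    u = mod-reflexive (ℤ.+-identityʳ (elementary 0 u))
  elementary-false+true (suc k) u = +-double (elementary (suc k) u) (elementary k u)

  -- Let e′ₖ omit the first variable. Since (1 + x₁)² is even, e′ₖ₊₁ is congruent to eₖ₊₁ + (1 + x₁)
  -- eₖ, which lowers the least index by one.
  ideal-lower : ∀ {g : CubeFunction n} → Ideal (suc a) g → Ideal a (branch g 0ᶠ)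
  ideal-lower (generator (suc k) s a<k k<H) = respects
    (λ { (false ∷ u) →
           let x = elementary (suc k) (u ⊕ s)
               y = elementary k (u ⊕ s)
           in mod-trans (mod-reflexive (ℤ.+-assoc (x + y) _ _))
             (mod-trans (mod-+ (mod-refl {x = x + y}) (elementary-false+true k (u ⊕ s))) (+-double x y))
       ; (true ∷ u) →
           let y = elementary k (u ⊕ s)
           in mod-trans (mod-reflexive (lemma y (elementary k (true ∷ u ⊕ s)) _))
             (mod-trans (mod-+ (mod-refl {x = y}) (elementary-false+true k (u ⊕ s))) (double≡0 y)) })
    (add (add (generator (suc k) (false ∷ s) (ℕ.m≤n⇒m≤1+n (s≤s⁻¹ a<k)) k<H)
              (generator k (false ∷ s) (s≤s⁻¹ a<k) (ℕ.<-trans (ℕ.n<1+n k) k<H)))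
         (generator k (true ∷ s) (s≤s⁻¹ a<k) (ℕ.<-trans (ℕ.n<1+n k) k<H)))
    where
    lemma : ∀ x y z → x + y + z ≡ x + (z + y)
    lemma = solve-∀
  ideal-lower (add I J) = respects (λ { (false ∷ u) → mod-refl ; (true ∷ u) → mod-refl })
    (add (ideal-lower I) (ideal-lower J))
  ideal-lower (respects f≡g I) = respects (λ { (false ∷ u) → f≡g u ; (true ∷ u) → mod-refl }) (ideal-lower I)

  -- The coefficient of x₁ in eₖ₊₁ is e′ₖ. For k = H - 1, where eₖ₊₁ is not a generator, (1 + x₁) eₖ
  -- has this coefficient modulo 2, and then k > a because a + 1 < H.
  ideal-upper : ∀ {g : CubeFunction n} → suc a < H → Ideal a g → ∃[ f ] Ideal (suc a) (branch f g)
  ideal-upper 1+a<H (generator k s a≤k k<H) with suc k ℕ.<? H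
  ... | yes 1+k<H = _ , respects (λ { (false ∷ u) → mod-refl ; (true ∷ u) → mod-refl })
                          (generator (suc k) (false ∷ s) (s≤s a≤k) 1+k<H)
  ... | no  1+k≮H = _ , respects
    (λ { (false ∷ u) → mod-refl
       ; (true ∷ u)  → mod-trans (mod-reflexive (ℤ.+-comm (elementary k (true ∷ u ⊕ s)) _))
                               (elementary-false+true k (u ⊕ s)) })
    (add (generator k (false ∷ s) a<k k<H) (generator k (true ∷ s) a<k k<H))
    where
    a<k = s≤s⁻¹ (ℕ.<-≤-trans 1+a<H (ℕ.≮⇒≥ 1+k≮H))
  ideal-upper 1+a<H (add I J) =
    let f₁ , I′ = ideal-upper 1+a<H I
        f₂ , J′ = ideal-upper 1+a<H J
    in (λ u → f₁ u + f₂ u)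
     , respects (λ { (false ∷ u) → mod-refl ; (true ∷ u) → mod-refl }) (add I′ J′)
  ideal-upper 1+a<H (respects f≡g I) =
    let f₁ , I′ = ideal-upper 1+a<H I
    in f₁ , respects (λ { (false ∷ u) → mod-refl ; (true ∷ u) → f≡g u }) I′

module _ (h : ℕ) where

  -- At height a the indices start with a + 1. A step up leaves x₁ out of the leading monomial, a
  -- step down puts it in. At -1 the ideal contains e₀ = 1, hence all monomials.
  idealFamily : ∀ n a b → a ℕ.+ b ≡ h → Family (Ideal (suc h) (suc a) {n}) (badPaths n a b)
  idealFamily n       a       zero    a+b≡h = emptyFamily
  idealFamily zero    a       (suc b) a+b≡h = emptyFamily
  idealFamily (suc n) zero    (suc b) refl  = joinFamilies
    (ideal-lower (suc h))
    (λ (s , g≡s) → ideal-upper (suc h) (s<s z<s)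
      (respects (λ u → mod-sym (g≡s u)) (generator 0 s z≤n z<s)))
    (idealFamily n 1 b refl)
    (monomials n)
  idealFamily (suc n) (suc a) (suc b) refl  = joinFamilies
    (ideal-lower (suc h))
    (ideal-upper (suc h) (s<s (s<s (ℕ.m<m+n a z<s))))
    (idealFamily n (2 ℕ.+ a) b (cong suc (sym (ℕ.+-suc a b))))
    (idealFamily n a (2 ℕ.+ b) (ℕ.+-suc a (suc b)))

-- The image of the adjacency matrix modulo a power of 2

halve : ∀ k → ∃[ j ] (k ≡ j ℕ.* 2 ⊎ k ≡ 1 ℕ.+ j ℕ.* 2)
halve zero    = 0 , inj₁ refl
halve (suc k) with halve k
... | j , inj₁ eq = j , inj₂ (cong suc eq)
... | j , inj₂ eq = suc j , inj₁ (cong suc eq)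

mod-scale : ∀ {x y m} → x ≡ y [mod + m ] → + 2 * x ≡ + 2 * y [mod + (2 ℕ.* m) ]
mod-scale {x} {y} {m} (mod p) =
  mod (subst₂ _∣ℤ_ (sym (ℤ.pos-* 2 m)) (lemma x y) (*-monoʳ-∣ (+ 2) p))
  where
  lemma : ∀ x y → + 2 * (x - y) ≡ + 2 * x - + 2 * y
  lemma = solve-∀

mod-2^ : ∀ i {x y} → x ≡ y [mod + 2 ] → + (2 ^ i) * x ≡ + (2 ^ i) * y [mod + (2 ^ suc i) ]
mod-2^ i {x} {y} (mod p) =
  mod (subst₂ _∣ℤ_ (trans (sym (ℤ.pos-* (2 ^ i) 2)) (cong (λ m → + m) (ℕ.*-comm (2 ^ i) 2)))
    (lemma (+ (2 ^ i)) x y) (*-monoʳ-∣ (+ (2 ^ i)) p))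
  where
  lemma : ∀ c x y → c * (x - y) ≡ c * x - c * y
  lemma = solve-∀

-- Bézout: gcd(k, 2^(i+1)) divides 2^i.
multiplier : ∀ i k → 0 < k → k < 2 ^ suc i → ∃[ ρ ] ρ * + k ≡ + (2 ^ i) [mod + (2 ^ suc i) ]
multiplier i k 0<k k<2^ with halve k
-- Multiplication by an odd k fixes 2ⁱ modulo 2^(i+1).
multiplier i k 0<k k<2^ | j , inj₂ refl =
  + (2 ^ i) , mod-trans (mod-2^ i odd) (mod-reflexive (ℤ.*-identityʳ _))
  where
  odd : + (1 ℕ.+ j ℕ.* 2) ≡ 1ℤ [mod + 2 ]
  odd = mod (divides (+ j) (trans (lemma (+ (j ℕ.* 2))) (ℤ.pos-* j 2)))
    where
    lemma : ∀ x → 1ℤ + x - 1ℤ ≡ x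
    lemma = solve-∀
multiplier zero    k 0<k k<2^ | suc j , inj₁ refl = contradiction k<2^ (ℕ.m+n≮m 2 (j ℕ.* 2))
multiplier (suc i) k 0<k k<2^ | suc j , inj₁ refl
  with multiplier i (suc j) z<s (ℕ.*-cancelʳ-< 2 _ _ (subst (suc j ℕ.* 2 <_) (ℕ.*-comm 2 (2 ^ suc i)) k<2^))
... | ρ , p = ρ , mod-trans
  (mod-reflexive (trans (cong (ρ *_) (ℤ.pos-* (suc j) 2)) (lemma ρ (+ suc j))))
  (mod-trans (mod-scale p) (mod-reflexive (sym (ℤ.pos-* 2 (2 ^ i)))))
  where
  lemma : ∀ x y → x * (y * + 2) ≡ + 2 * (x * y)
  lemma = solve-∀

Attained : ℕ → CubeFunction n → Set
Attained i g = ∃[ w ] ∀ u → neighbourSum w u ≡ + (2 ^ i) * g u [mod + (2 ^ suc i) ]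

-- If ρ k is congruent to 2ⁱ, then ρ pₖ is sent to ρ k cₖ, congruent to 2ⁱ eₖ. The least index 1
-- makes k positive.
ideal⇒attained : ∀ i → 2 ℕ.∣ n → {g : CubeFunction n} → Ideal (2 ^ suc i) 1 g → Attained i g
ideal⇒attained i (ℕ.divides r n≡r*2) (generator k s 0<k k<H) with multiplier i k 0<k k<H
... | ρ , ρk≡2^i = (λ u → ρ * potential r k (u ⊕ s)) , λ u →
  mod-trans (mod-reflexive (begin
    neighbourSum (λ v → ρ * potential r k (v ⊕ s)) u
      ≡⟨ neighbourSum-* ρ (λ v → potential r k (v ⊕ s)) u ⟩
    ρ * neighbourSum (λ v → potential r k (v ⊕ s)) u
      ≡⟨ cong (ρ *_) (neighbourSum-translate (potential r k) s u) ⟩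
    ρ * neighbourSum (potential r k) (u ⊕ s)
      ≡⟨ cong (ρ *_) (neighbourSum-potential {r = r} k (trans n≡r*2 (ℕ.*-comm r 2)) (u ⊕ s)) ⟩
    ρ * (+ k * centred r k (u ⊕ s))
      ≡⟨ ℤ.*-assoc ρ (+ k) (centred r k (u ⊕ s)) ⟨
    ρ * + k * centred r k (u ⊕ s) ∎))
  (mod-trans (mod-* ρk≡2^i (mod-refl {x = centred r k (u ⊕ s)})) (mod-2^ i (centred≡elementary r k (u ⊕ s))))
  where open ≡-Reasoning
ideal⇒attained i even (add {f = f} {g = g} I J) =
  let w₁ , p₁ = ideal⇒attained i even I
      w₂ , p₂ = ideal⇒attained i even J
  in (λ u → w₁ u + w₂ u) , λ u → mod-trans (mod-reflexive (neighbourSum-+ w₁ w₂ u))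
       (mod-trans (mod-+ (p₁ u) (p₂ u)) (mod-reflexive (sym (ℤ.*-distribˡ-+ (+ (2 ^ i)) (f u) (g u)))))
ideal⇒attained i even (respects f≡g I) =
  let w , p = ideal⇒attained i even I
  in w , λ u → mod-trans (p u) (mod-2^ i (f≡g u))

-- Elementary divisors

euclid₂ : ∀ {x y} → + 2 ∣ℤ x * y → + 2 ∣ℤ x ⊎ + 2 ∣ℤ y
euclid₂ {x} {y} p = Sum.map ∣ᵤ⇒∣ ∣ᵤ⇒∣
  (euclidsLemma ℤ.∣ x ∣ ℤ.∣ y ∣ prime[2] (subst (2 ℕ.∣_) (ℤ.abs-* x y) (∣⇒∣ᵤ p)))

2^∣*odd : ∀ i {x y} → ¬ + 2 ∣ℤ y → + (2 ^ i) ∣ℤ x * y → + (2 ^ i) ∣ℤ x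
2^∣*odd zero    {x}     odd p = divides x (sym (ℤ.*-identityʳ x))
2^∣*odd (suc i) {x} {y} odd p with 2^∣*odd i {x} {y} odd (∣-trans (∣ᵤ⇒∣ (ℕ.divides 2 refl)) p)
... | divides q refl = [ (λ { (divides r refl) → divides r (trans (ℤ.*-assoc r (+ 2) (+ (2 ^ i)))
                                                              (cong (r *_) (sym (ℤ.pos-* 2 (2 ^ i))))) })
                       , (λ even → contradiction even odd) ]′
  (euclid₂ {q} {y} (*-cancelˡ-∣ (+ (2 ^ i)) {{ℕ.m^n≢0 2 i}}
    (subst₂ _∣ℤ_ (trans (cong (λ m → + m) (ℕ.*-comm 2 (2 ^ i))) (ℤ.pos-* (2 ^ i) 2)) (lemma q (+ (2 ^ i)) y) p)))
  where
  lemma : ∀ q z y → q * z * y ≡ z * (q * y)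
  lemma = solve-∀

module F₂ where
  open Elimination (ℤ-mod (+ 2)) public
  zero? : ∀ x → Dec (x ≡ 0ℤ [mod + 2 ])
  zero? x = Dec.map′ ∣⇒mod mod⇒∣ (+ 2 ∣? x)

  noZeroDivisors : ∀ {x y} → x * y ≡ 0ℤ [mod + 2 ] → x ≡ 0ℤ [mod + 2 ] ⊎ y ≡ 0ℤ [mod + 2 ]
  noZeroDivisors {x} {y} p = Sum.map ∣⇒mod ∣⇒mod (euclid₂ {x} {y} (mod⇒∣ p))

  1≢0 : ¬ 1ℤ ≡ 0ℤ [mod + 2 ]
  1≢0 p = ℕ.>⇒∤ (ℕ.n<1+n 1) (∣⇒∣ᵤ (mod⇒∣ p))

infixr 8 _·_
_·_ : Matrix ℤ N → (Fin N → ℤ) → Fin N → ℤ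
(X · v) i = sumℤ (λ k → X i k * v k)

·-cong : ∀ (X : Matrix ℤ N) {v w : Fin N → ℤ} → (∀ j → v j ≡ w j) → ∀ i → (X · v) i ≡ (X · w) i
·-cong X v≡w i = sumℤ-cong (λ k → cong (X i k *_) (v≡w k))

·-congˡ : ∀ {X Y : Matrix ℤ N} (v : Fin N → ℤ) → X ≈ Y → ∀ i → (X · v) i ≡ (Y · v) i
·-congˡ v X≈Y i = sumℤ-cong (λ k → cong (_* v k) (X≈Y i k))

·-mod : ∀ (X : Matrix ℤ N) {v w : Fin N → ℤ} →
        (∀ j → v j ≡ w j [mod d ]) → ∀ i → (X · v) i ≡ (X · w) i [mod d ]
·-mod X v≡w i = sumℤ-mod (λ k → mod-* (mod-refl {x = X i k}) (v≡w k))

·-mod-0 : ∀ (X : Matrix ℤ N) {v : Fin N → ℤ} →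
          (∀ j → v j ≡ 0ℤ [mod d ]) → ∀ i → (X · v) i ≡ 0ℤ [mod d ]
·-mod-0 X v≡0 i = sumℤ-mod-0 _ (λ k →
  mod-trans (mod-* (mod-refl {x = X i k}) (v≡0 k)) (mod-reflexive (ℤ.*-zeroʳ (X i k))))

∙-· : ∀ (X Y : Matrix ℤ N) v i → ((X ∙ Y) · v) i ≡ (X · Y · v) i
∙-· X Y v i = begin
  sumℤ (λ k → sumℤ (λ j → X i j * Y j k) * v k)
    ≡⟨ sumℤ-cong (λ k → *-distribʳ-sum (v k) (λ j → X i j * Y j k)) ⟩
  sumℤ (λ k → sumℤ (λ j → X i j * Y j k * v k))
    ≡⟨ ∑-comm (λ k j → X i j * Y j k * v k) ⟩
  sumℤ (λ j → sumℤ (λ k → X i j * Y j k * v k))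
    ≡⟨ sumℤ-cong (λ j → trans (sumℤ-cong (λ k → ℤ.*-assoc (X i j) (Y j k) (v k)))
                              (sym (*-distribˡ-sum (X i j) (λ k → Y j k * v k)))) ⟩
  (X · Y · v) i ∎
  where open ≡-Reasoning

·-combination : ∀ (X : Matrix ℤ N) (c : Fin k → ℤ) (g : Fin k → Fin N → ℤ) i →
  (X · (λ j → sumℤ (λ l → c l * g l j))) i ≡ sumℤ (λ l → c l * (X · g l) i)
·-combination X c g i = begin
  sumℤ (λ j → X i j * sumℤ (λ l → c l * g l j))
    ≡⟨ sumℤ-cong (λ j → *-distribˡ-sum (X i j) (λ l → c l * g l j)) ⟩
  sumℤ (λ j → sumℤ (λ l → X i j * (c l * g l j)))
    ≡⟨ ∑-comm (λ j l → X i j * (c l * g l j)) ⟩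
  sumℤ (λ l → sumℤ (λ j → X i j * (c l * g l j)))
    ≡⟨ sumℤ-cong (λ l → trans (sumℤ-cong (λ j → lemma (X i j) (c l) (g l j)))
                              (sym (*-distribˡ-sum (c l) (λ j → X i j * g l j)))) ⟩
  sumℤ (λ l → c l * (X · g l) i) ∎
  where
  open ≡-Reasoning
  lemma : ∀ x y z → x * (y * z) ≡ y * (x * z)
  lemma = solve-∀

diagonal-· : ∀ {D : Matrix ℤ N} → IsDiagonal D → ∀ v i → (D · v) i ≡ D i i * v i
diagonal-· {D = D} diag v i = sum-single i (λ j → D i j * v j)
  (λ j j≢i → cong (_* v j) (diag i j (j≢i ∘ sym)))

identity-· : ∀ (v : Fin N → ℤ) i → (identity · v) i ≡ v i
identity-· v i = trans
  (sum-single i (λ j → identity i j * v j)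
    (λ j j≢i → cong (λ b → (if b then 1ℤ else 0ℤ) * v j) (dec-false (i Fin.≟ j) (j≢i ∘ sym))))
  (trans (cong (λ b → (if b then 1ℤ else 0ℤ) * v i) (dec-true (i Fin.≟ i) refl)) (ℤ.*-identityˡ (v i)))

inverse-· : ∀ (X Y : Matrix ℤ N) → X ∙ Y ≈ identity → ∀ v i → (X · Y · v) i ≡ v i
inverse-· X Y XY≈1 v i = trans (sym (∙-· X Y v i)) (trans (·-congˡ v XY≈1 i) (identity-· v i))

-- Indexes the equations of a linear system restricted to the positions where P holds.
enumerate : ∀ {P : Pred ℤ 0ℓ} (P? : Decidable P) (d : Fin N → ℤ) →
            Σ[ es ∈ (Fin (count P? (tabulate d)) → Fin N) ] (∀ j → P (d j) → ∃[ x ] es x ≡ j)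
enumerate {zero}  P? d = (λ ()) , λ ()
enumerate {suc N} P? d with P? (d zero) | enumerate P? (d ∘ suc)
... | yes p | es , hit = (λ { zero → zero ; (suc x) → suc (es x) })
                       , λ { zero _ → zero , refl
                           ; (suc j) q → let x , eq = hit j q in suc x , cong suc eq }
... | no ¬p | es , hit = (λ x → suc (es x))
                       , λ { zero q → contradiction q ¬p
                           ; (suc j) q → let x , eq = hit j q in x , cong suc eq }

-- For larger k, elimination gives a nontrivial combination modulo 2 whose image under B vanishes
-- where P holds, and by hypothesis it vanishes elsewhere. Applying B⁻¹, the combination itself
-- vanishes, against independence.
independent⇒≤count : {P : Pred ℤ 0ℓ} (P? : Decidable P) (d : Fin N → ℤ) (B B⁻¹ : Matrix ℤ N) →
  B⁻¹ ∙ B ≈ identity → (g : Fin k → Fin N → ℤ) →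
  (∀ (c : Fin k → ℤ) → (∀ j → sumℤ (λ l → c l * g l j) ≡ 0ℤ [mod + 2 ]) → ∀ l → c l ≡ 0ℤ [mod + 2 ]) →
  (∀ l j → ¬ P (d j) → (B · g l) j ≡ 0ℤ [mod + 2 ]) →
  k ≤ count P? (tabulate d)
independent⇒≤count {k = k} {P = P} P? d B B⁻¹ inv g independent even = ℕ.≮⇒≥ λ lt →
  let es , hit = enumerate P? d
      u , (l , ul≢0) , sol =
        F₂.nontrivialSolution F₂.zero? F₂.noZeroDivisors F₂.1≢0 (λ x l → (B · g l) (es x)) lt
      vanish : ∀ j → sumℤ (λ l → u l * (B · g l) j) ≡ 0ℤ [mod + 2 ]
      vanish j = case P? (d j) of λ where
        (yes p) → let x , eq = hit j p in
                  subst (λ j → sumℤ (λ l → u l * (B · g l) j) ≡ 0ℤ [mod + 2 ]) eq (sol x)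
        (no ¬p) → sumℤ-mod-0 _ (λ l →
                  mod-trans (mod-* (mod-refl {x = u l}) (even l j ¬p)) (mod-reflexive (ℤ.*-zeroʳ (u l))))
  in ul≢0 (independent u (λ j → mod-trans
       (mod-reflexive (trans (sym (inverse-· B⁻¹ B inv (λ j → sumℤ (λ l → u l * g l j)) j))
                             (·-cong B⁻¹ (·-combination B u g) j)))
       (·-mod-0 B⁻¹ vanish j)) l)

count-complement : {P : Pred ℤ 0ℓ} (P? : Decidable P) (v : Vec ℤ N) → count P? v ℕ.+ count (¬? ∘ P?) v ≡ N
count-complement P? []      = refl
count-complement P? (x ∷ v) with P? x
... | yes _ = cong suc (count-complement P? v)
... | no _  = trans (ℕ.+-suc _ _) (cong suc (count-complement P? v))

·-scale : ∀ a (X : Matrix ℤ N) v i → (X · (λ j → a * v j)) i ≡ a * (X · v) i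
·-scale a X v i = trans (sumℤ-cong (λ j → lemma (X i j) a (v j))) (sym (*-distribˡ-sum a (λ j → X i j * v j)))
  where
  lemma : ∀ x a y → x * (a * y) ≡ a * (x * y)
  lemma = solve-∀

-- Elementary divisors of the cube

module CubeMatrix {n} {A : Matrix ℤ (2 ^ n)} (cube : IsCubeAdjacencyMatrix n A) where

  open IsCubeAdjacencyMatrix cube
  open Ordering ordering

  ·-neighbourSum : ∀ f i → (A · (f ∘ to)) i ≡ neighbourSum f (to i)
  ·-neighbourSum f i = sum-neighbours ordering i (λ j → A i j * f (to j)) f
    (λ j adj → trans (cong (_* f (to j)) (adjacent i j adj)) (ℤ.*-identityˡ _))
    (λ j ¬adj → cong (_* f (to j)) (nonadjacent i j ¬adj))

  independent-to : ∀ {P k} (G : Family P k) (c : Fin k → ℤ) →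
    (∀ j → sumℤ (λ l → c l * Family.element G l (to j)) ≡ 0ℤ [mod + 2 ]) → ∀ l → c l ≡ 0ℤ [mod + 2 ]
  independent-to G c Σ≡0 = Family.independence G c λ u →
    subst (λ u → sumℤ (λ l → c l * Family.element G l u) ≡ 0ℤ [mod + 2 ]) (to-from u) (Σ≡0 (from u))

  module _ {D : Matrix ℤ (2 ^ n)} (diag : IsDiagonal D) (P P⁻¹ Q Q⁻¹ : Matrix ℤ (2 ^ n))
    (P⁻¹P : P⁻¹ ∙ P ≈ identity) (QQ⁻¹ : Q ∙ Q⁻¹ ≈ identity) (PAQ : P ∙ A ∙ Q ≈ D)
    (2∣n : 2 ℕ.∣ n) where

    -- P A = D Q⁻¹, read entrywise.
    diagonal-entry : ∀ v j → D j j * (Q⁻¹ · v) j ≡ (P · A · v) j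
    diagonal-entry v j = begin
      D j j * (Q⁻¹ · v) j             ≡⟨ diagonal-· diag (Q⁻¹ · v) j ⟨
      (D · Q⁻¹ · v) j                 ≡⟨ ·-congˡ (Q⁻¹ · v) PAQ j ⟨
      ((P ∙ A ∙ Q) · Q⁻¹ · v) j       ≡⟨ ∙-· (P ∙ A) Q (Q⁻¹ · v) j ⟩
      ((P ∙ A) · Q · Q⁻¹ · v) j       ≡⟨ ·-cong (P ∙ A) (inverse-· Q Q⁻¹ QQ⁻¹ v) j ⟩
      ((P ∙ A) · v) j                 ≡⟨ ∙-· P A v j ⟩
      (P · A · v) j                   ∎
      where open ≡-Reasoning

    -- A lift v of g is annihilated by A modulo 2^(i+1), so this modulus divides the product of D j
    -- j and the j-th entry of Q⁻¹ v. If that entry were odd, it would divide D j j.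
    liftable-even : ∀ i h (eq : suc h ≡ 2 ^ suc i) {g : CubeFunction n} → Liftable i h eq 0 g →
                    ∀ j → ¬ + (2 ^ suc i) ∣ℤ D j j → (Q⁻¹ · (g ∘ to)) j ≡ 0ℤ [mod + 2 ]
    liftable-even i h eq {g} L j ∤D = mod-trans
      (·-mod Q⁻¹ (λ j → mod-sym (Liftable.leading L (to j))) j)
      (∣⇒mod (decidable-stable (+ 2 ∣? w j) λ odd → ∤D (2^∣*odd (suc i) odd divisible)))
      where
      v : CubeFunction n
      v = Liftable.W L []
      w : Fin (2 ^ n) → ℤ
      w = Q⁻¹ · (v ∘ to)
      annihilated : ∀ j → (A · (v ∘ to)) j ≡ 0ℤ [mod + (2 ^ suc i) ]
      annihilated j = mod-trans
        (mod-reflexive (trans (·-neighbourSum v j) (sym (ℤ.+-identityˡ _)))) (Liftable.annihilate L [] (to j))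
      divisible : + (2 ^ suc i) ∣ℤ D j j * w j
      divisible = mod⇒∣ (mod-trans (mod-reflexive (diagonal-entry (v ∘ to) j)) (·-mod-0 P annihilated j))

    -- If A v is congruent to 2ⁱ g, then 2ⁱ times the j-th entry of P g is congruent to an entry of
    -- D Q⁻¹ v, hence to 0 modulo 2^(i+1). Cancelling 2ⁱ leaves a factor 2.
    attained-even : ∀ i {g : CubeFunction n} → Attained i g →
                    ∀ j → + (2 ^ suc i) ∣ℤ D j j → (P · (g ∘ to)) j ≡ 0ℤ [mod + 2 ]
    attained-even i {g} (v , Av≡) j ∣D = ∣⇒mod
      (*-cancelˡ-∣ (+ (2 ^ i)) {{ℕ.m^n≢0 2 i}}
        (subst (_∣ℤ + (2 ^ i) * x) 2^[1+i] (mod⇒∣ (mod-trans (mod-sym scaled) zeroed))))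
      where
      x : ℤ
      x = (P · (g ∘ to)) j
      2^[1+i] : + (2 ^ suc i) ≡ + (2 ^ i) * + 2
      2^[1+i] = trans (cong (λ m → + m) (ℕ.*-comm 2 (2 ^ i))) (ℤ.pos-* (2 ^ i) 2)
      zeroed : (P · A · (v ∘ to)) j ≡ 0ℤ [mod + (2 ^ suc i) ]
      zeroed = mod-trans (mod-reflexive (sym (diagonal-entry (v ∘ to) j))) (∣⇒mod (∣m⇒∣m*n _ ∣D))
      scaled : (P · A · (v ∘ to)) j ≡ + (2 ^ i) * x [mod + (2 ^ suc i) ]
      scaled = mod-trans (·-mod P (λ j → mod-trans (mod-reflexive (·-neighbourSum v j)) (Av≡ (to j))) j)
        (mod-reflexive (·-scale (+ (2 ^ i)) P (g ∘ to) j))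

    -- The two families bound from below the numbers of divisible and of other entries. The bounds
    -- add up to 2ⁿ, so both are attained.
    count≡goodPaths : ∀ i h → suc h ≡ 2 ^ suc i →
                      count (+ (2 ^ suc i) ∣?_) (diagonal D) ≡ goodPaths n 0 h
    count≡goodPaths i h eq = ℕ.≤-antisym
      (ℕ.+-cancelʳ-≤ (badPaths n 0 h) _ _ (begin
        count divisible? (diagonal D) ℕ.+ badPaths n 0 h
          ≤⟨ ℕ.+-monoʳ-≤ (count divisible? (diagonal D)) upper ⟩
        count divisible? (diagonal D) ℕ.+ count (¬? ∘ divisible?) (diagonal D)
          ≡⟨ count-complement divisible? (diagonal D) ⟩
        2 ^ n
          ≡⟨ goodPaths+badPaths n 0 h ⟨
        goodPaths n 0 h ℕ.+ badPaths n 0 h ∎))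
      lower
      where
      open ℕ.≤-Reasoning
      divisible? = + (2 ^ suc i) ∣?_
      𝓛 = liftableFamily i h eq n 0 h refl 2∣n
      𝓘 = idealFamily h n 0 h refl
      lower : goodPaths n 0 h ≤ count divisible? (diagonal D)
      lower = independent⇒≤count divisible? (λ j → D j j) Q⁻¹ Q QQ⁻¹ (λ l → Family.element 𝓛 l ∘ to)
        (independent-to 𝓛) (λ l → liftable-even i h eq (Family.property 𝓛 l))
      upper : badPaths n 0 h ≤ count (¬? ∘ divisible?) (diagonal D)
      upper = independent⇒≤count (¬? ∘ divisible?) (λ j → D j j) P P⁻¹ P⁻¹P (λ l → Family.element 𝓘 l ∘ to)
        (independent-to 𝓘) (λ l j ¬¬∣ → attained-even i
          (ideal⇒attained i 2∣n (subst (λ H → Ideal H 1 (Family.element 𝓘 l)) eq (Family.property 𝓘 l)))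
          j (decidable-stable (divisible? (D j j)) ¬¬∣))

-- Counting paths by reflection

pathEnds : ℕ → ℤ → List ℤ
pathEnds zero    a = a ∷ []
pathEnds (suc n) a = pathEnds n (1ℤ + a) ++ pathEnds n (-1ℤ + a)

-- Here H = h + 2, so that the upper barrier H - 1 is h + 1.
module _ (h : ℕ) (H-even : 2 ℕ.∣ suc (suc h)) where

  private
    M : ℤ
    M = + (2 ℕ.* suc (suc h))

  χ : ℕ → ℤ → ℕ
  χ n a = length (filter (M ∣?_) (pathEnds n a))

  χ-suc : ∀ n a → χ (suc n) a ≡ χ n (1ℤ + a) ℕ.+ χ n (-1ℤ + a)
  χ-suc n a = trans
    (cong length (List.filter-++ (M ∣?_) (pathEnds n (1ℤ + a)) (pathEnds n (-1ℤ + a))))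
    (List.length-++ (filter (M ∣?_) (pathEnds n (1ℤ + a))))

  χ₀-∣ : ∀ a → M ∣ℤ a → χ 0 a ≡ 1
  χ₀-∣ a p = cong length (List.filter-accept (M ∣?_) p)

  χ₀-∤ : ∀ a → ¬ M ∣ℤ a → χ 0 a ≡ 0
  χ₀-∤ a ¬p = cong length (List.filter-reject (M ∣?_) ¬p)

  χ₀-cong : ∀ a b → (M ∣ℤ a → M ∣ℤ b) → (M ∣ℤ b → M ∣ℤ a) → χ 0 a ≡ χ 0 b
  χ₀-cong a b to from = case M ∣? a of λ where
    (yes p) → trans (χ₀-∣ a p) (sym (χ₀-∣ b (to p)))
    (no ¬p) → trans (χ₀-∤ a ¬p) (sym (χ₀-∤ b (λ q → ¬p (from q))))

  χ-neg : ∀ n a → χ n (- a) ≡ χ n a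
  χ-neg zero    a = χ₀-cong (- a) a (λ p → subst (M ∣ℤ_) (ℤ.neg-involutive a) (∣m⇒∣-m p)) ∣m⇒∣-m
  χ-neg (suc n) a = begin
    χ (suc n) (- a)                          ≡⟨ χ-suc n (- a) ⟩
    χ n (1ℤ + - a) ℕ.+ χ n (-1ℤ + - a)       ≡⟨ cong₂ (λ x y → χ n x ℕ.+ χ n y) (lemma₁ a) (lemma₂ a) ⟩
    χ n (- (-1ℤ + a)) ℕ.+ χ n (- (1ℤ + a))   ≡⟨ cong₂ ℕ._+_ (χ-neg n (-1ℤ + a)) (χ-neg n (1ℤ + a)) ⟩
    χ n (-1ℤ + a) ℕ.+ χ n (1ℤ + a)           ≡⟨ ℕ.+-comm (χ n (-1ℤ + a)) _ ⟩
    χ n (1ℤ + a) ℕ.+ χ n (-1ℤ + a)           ≡⟨ χ-suc n a ⟨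
    χ (suc n) a                              ∎
    where
    open ≡-Reasoning
    lemma₁ : ∀ a → 1ℤ + - a ≡ - (-1ℤ + a)
    lemma₁ = solve-∀
    lemma₂ : ∀ a → -1ℤ + - a ≡ - (1ℤ + a)
    lemma₂ = solve-∀

  χ-periodic : ∀ n a → χ n (M + a) ≡ χ n a
  χ-periodic zero    a = χ₀-cong (M + a) a (λ p → ∣m+n∣m⇒∣n p ∣-refl) (∣m∣n⇒∣m+n ∣-refl)
  χ-periodic (suc n) a = begin
    χ (suc n) (M + a)                        ≡⟨ χ-suc n (M + a) ⟩
    χ n (1ℤ + (M + a)) ℕ.+ χ n (-1ℤ + (M + a))
      ≡⟨ cong₂ (λ x y → χ n x ℕ.+ χ n y) (lemma 1ℤ M a) (lemma -1ℤ M a) ⟩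
    χ n (M + (1ℤ + a)) ℕ.+ χ n (M + (-1ℤ + a))
      ≡⟨ cong₂ ℕ._+_ (χ-periodic n (1ℤ + a)) (χ-periodic n (-1ℤ + a)) ⟩
    χ n (1ℤ + a) ℕ.+ χ n (-1ℤ + a)           ≡⟨ χ-suc n a ⟨
    χ (suc n) a                              ∎
    where
    open ≡-Reasoning
    lemma : ∀ x y z → x + (y + z) ≡ y + (x + z)
    lemma = solve-∀

  -- Negation followed by the translation by 2H is the reflection at H.
  χ-reflect : ∀ n → χ n (+ suc (suc (suc h))) ≡ χ n (+ suc h)
  χ-reflect n = begin
    χ n (+ suc (suc (suc h)))       ≡⟨ χ-neg n (+ suc (suc (suc h))) ⟨
    χ n (- (+ suc (suc (suc h))))   ≡⟨ χ-periodic n (- (+ suc (suc (suc h)))) ⟨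
    χ n (M - + suc (suc (suc h)))   ≡⟨ cong (λ m → χ n (m - + suc (suc (suc h)))) (ℤ.pos-* 2 (suc (suc h))) ⟩
    χ n (+ 2 * (+ 2 + + h) - (+ 3 + + h)) ≡⟨ cong (χ n) (lemma (+ h)) ⟩
    χ n (+ suc h)                   ∎
    where
    open ≡-Reasoning
    lemma : ∀ h → + 2 * (+ 2 + h) - (+ 3 + h) ≡ 1ℤ + h
    lemma = solve-∀

  χ₀-< : ∀ a → suc a < 2 ℕ.* suc (suc h) → χ 0 (+ suc a) ≡ 0
  χ₀-< a a<M = χ₀-∤ (+ suc a) (λ p → ℕ.>⇒∤ a<M (∣⇒∣ᵤ p))

  -- Extended to ℤ by reflection at −1 and h + 1, the initial values of goodPaths at
  -- the even integers jump by 2 at the multiples of 2(h + 2), and are constant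
  -- elsewhere: this is the resulting sum over the ends of the paths.
  folded : ℕ → ℕ → ℕ
  folded n zero          = χ n 0ℤ
  folded n (suc zero)    = 2 ℕ.* χ n 1ℤ
  folded n (suc (suc a)) = folded n a ℕ.+ 2 ℕ.* χ n (+ suc (suc a))

  -- By symmetry the steps from 0 to 1 and to -1 contribute equally, which is the rule of
  -- `goodPaths` at the lower barrier.
  folded-zero : ∀ n → folded (suc n) 0 ≡ folded n 1
  folded-zero n = trans (χ-suc n 0ℤ) (cong (χ n 1ℤ ℕ.+_) (trans (χ-neg n 1ℤ) (sym (ℕ.+-identityʳ (χ n 1ℤ)))))

  folded-suc : ∀ n a → folded (suc n) (suc a) ≡ folded n a ℕ.+ folded n (2 ℕ.+ a)
  folded-suc n zero = trans (cong (2 ℕ.*_) (χ-suc n 1ℤ)) (lemma (χ n (+ 2)) (χ n 0ℤ))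
    where
    lemma : ∀ x y → 2 ℕ.* (x ℕ.+ y) ≡ y ℕ.+ (y ℕ.+ 2 ℕ.* x)
    lemma = solveℕ-∀
  folded-suc n (suc zero) = trans (cong₂ (λ x y → x ℕ.+ 2 ℕ.* y) (folded-zero n) (χ-suc n (+ 2)))
    (lemma (χ n 1ℤ) (χ n (+ 3)))
    where
    lemma : ∀ x y → 2 ℕ.* x ℕ.+ 2 ℕ.* (y ℕ.+ x) ≡ 2 ℕ.* x ℕ.+ (2 ℕ.* x ℕ.+ 2 ℕ.* y)
    lemma = solveℕ-∀
  folded-suc n (suc (suc a)) = trans
    (cong₂ (λ x y → x ℕ.+ 2 ℕ.* y) (folded-suc n a) (χ-suc n (+ (3 ℕ.+ a))))
    (lemma (folded n a) (folded n (2 ℕ.+ a)) (χ n (+ (4 ℕ.+ a))) (χ n (+ (2 ℕ.+ a))))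
    where
    lemma : ∀ x y z w → x ℕ.+ (x ℕ.+ 2 ℕ.* w) ℕ.+ 2 ℕ.* (z ℕ.+ w) ≡
                        x ℕ.+ 2 ℕ.* w ℕ.+ (x ℕ.+ 2 ℕ.* w ℕ.+ 2 ℕ.* z)
    lemma = solveℕ-∀

  folded-double : ∀ n a → folded (suc n) a ℕ.+ 2 ℕ.* χ n (+ suc a) ≡ 2 ℕ.* folded n (suc a)
  folded-double n zero    = trans (cong (ℕ._+ 2 ℕ.* χ n 1ℤ) (folded-zero n)) (lemma (χ n 1ℤ))
    where
    lemma : ∀ x → 2 ℕ.* x ℕ.+ 2 ℕ.* x ≡ 2 ℕ.* (2 ℕ.* x)
    lemma = solveℕ-∀
  folded-double n (suc a) = trans (cong (ℕ._+ 2 ℕ.* χ n (+ suc (suc a))) (folded-suc n a))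
    (lemma (folded n a) (χ n (+ suc (suc a))))
    where
    lemma : ∀ x z → x ℕ.+ (x ℕ.+ 2 ℕ.* z) ℕ.+ 2 ℕ.* z ≡ 2 ℕ.* (x ℕ.+ 2 ℕ.* z)
    lemma = solveℕ-∀

  -- Among 0, 2, ..., 2r < 2H, only 0 is a multiple of 2H.
  folded₀ : ∀ r → r ℕ.* 2 < 2 ℕ.* suc (suc h) → folded 0 (r ℕ.* 2) ≡ 1
  folded₀ zero    _  = χ₀-∣ 0ℤ (divides 0ℤ refl)
  folded₀ (suc r) lt = cong₂ (λ x y → x ℕ.+ 2 ℕ.* y)
    (folded₀ r (ℕ.<-trans (ℕ.n<1+n _) (ℕ.<-trans (ℕ.n<1+n _) lt))) (χ₀-< (suc (r ℕ.* 2)) lt)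

  mutual
    -- By symmetry of χ, the left-hand sides here and in `folded-below-top` are sums of χ over all
    -- residues of one parity modulo 2H. Each of the 2ⁿ step sequences leads to a multiple of 2H
    -- from exactly one of them. The parities alternate in the induction.
    folded-top : ∀ n → 2 ℕ.∣ suc h ℕ.+ n → folded n (suc h) ≡ 2 ^ n
    -- H - 1 is odd, so n cannot be 0.
    folded-top zero    even = contradiction
      (ℕ.∣m+n∣m⇒∣n (subst (2 ℕ.∣_) (ℕ.+-comm 1 (suc h)) H-even) (subst (2 ℕ.∣_) (ℕ.+-identityʳ (suc h)) even))
      (ℕ.>⇒∤ (ℕ.n<1+n 1))
    folded-top (suc n) even = trans (folded-suc n h) (trans (lemma (folded n h) _)
      (cong (2 ℕ.*_) (folded-below-top n (subst (2 ℕ.∣_) (ℕ.+-suc (suc h) n) even))))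
      where
      lemma : ∀ x y → x ℕ.+ (x ℕ.+ 2 ℕ.* y) ≡ 2 ℕ.* (x ℕ.+ y)
      lemma = solveℕ-∀

    folded-below-top : ∀ n → 2 ℕ.∣ suc (suc h) ℕ.+ n → folded n h ℕ.+ χ n (+ suc (suc h)) ≡ 2 ^ n
    folded-below-top zero even = begin
      folded 0 h ℕ.+ χ 0 (+ suc (suc h)) ≡⟨ cong₂ ℕ._+_ folded₀h (χ₀-< (suc h) (ℕ.m<m+n (suc (suc h)) z<s)) ⟩
      1                             ∎
      where
      open ≡-Reasoning
      folded₀h : folded 0 h ≡ 1
      folded₀h with ℕ.∣m+n∣m⇒∣n H-even (ℕ.∣-refl {2})
      ... | ℕ.divides r refl = folded₀ r (ℕ.<-trans (ℕ.n<1+n _) (ℕ.<-trans (ℕ.n<1+n _) (ℕ.m<m+n _ z<s)))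
    folded-below-top (suc n) even = begin
      folded (suc n) h ℕ.+ χ (suc n) (+ suc (suc h))
        ≡⟨ cong (folded (suc n) h ℕ.+_) (trans (χ-suc n (+ suc (suc h))) (cong (ℕ._+ χ n (+ suc h)) (χ-reflect n))) ⟩
      folded (suc n) h ℕ.+ (χ n (+ suc h) ℕ.+ χ n (+ suc h))
        ≡⟨ cong (λ x → folded (suc n) h ℕ.+ (χ n (+ suc h) ℕ.+ x)) (ℕ.+-identityʳ _) ⟨
      folded (suc n) h ℕ.+ 2 ℕ.* χ n (+ suc h)
        ≡⟨ folded-double n h ⟩
      2 ℕ.* folded n (suc h)
        ≡⟨ cong (2 ℕ.*_) (folded-top n (2∣-pred² (suc h) n even)) ⟩
      2 ^ suc n ∎
      where open ≡-Reasoning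

  -- Both sides obey the same recursion and agree at the barriers and for n = 0.
  goodPaths≡folded : ∀ n a b → a ℕ.+ b ≡ suc h → 2 ℕ.∣ a ℕ.+ n → goodPaths n a b ≡ folded n a
  goodPaths≡folded n a zero a+b≡h even
    with refl ← trans (sym (ℕ.+-identityʳ a)) a+b≡h = sym (folded-top n even)
  goodPaths≡folded zero a (suc b) a+b≡h even
    with subst (2 ℕ.∣_) (ℕ.+-identityʳ a) even
  ... | ℕ.divides r refl = sym (folded₀ r (ℕ.≤-<-trans
    (ℕ.m+n≤o⇒m≤o _ (ℕ.≤-reflexive a+b≡h)) (ℕ.≤-trans (ℕ.n<1+n (suc h)) (ℕ.m≤m+n _ _))))
  goodPaths≡folded (suc n) zero (suc b) a+b≡h even = trans (goodPaths≡folded n 1 b a+b≡h even) (sym (folded-zero n))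
  goodPaths≡folded (suc n) (suc a) (suc b) a+b≡h even = trans
    (cong₂ ℕ._+_
      (goodPaths≡folded n a (2 ℕ.+ b) (trans (ℕ.+-suc a (suc b)) a+b≡h) (2∣-pred² a n even))
      (goodPaths≡folded n (2 ℕ.+ a) b (trans (cong suc (sym (ℕ.+-suc a b))) a+b≡h)
        (subst (2 ℕ.∣_) (cong suc (ℕ.+-suc a n)) even)))
    (sym (folded-suc n a))

-- Eigenspaces

private module ℚΣ = CubeSums ℚ.+-0-commutativeMonoid

fromℤ≡mkℚ : ∀ z → fromℤ z ≡ mkℚ z 0 (Coprime.sym (Coprime.1-coprimeTo ℤ.∣ z ∣))
fromℤ≡mkℚ z = ℚ.↥p/↧p≡p (mkℚ z 0 _)

fromℤ-injective : ∀ {x y} → fromℤ x ≡ fromℤ y → x ≡ y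
fromℤ-injective {x} {y} eq =
  cong ↥_ (trans (sym (fromℤ≡mkℚ x)) (trans eq (fromℤ≡mkℚ y)))

fromℤ-+ : ∀ x y → fromℤ (x + y) ≡ fromℤ x ℚ.+ fromℤ y
fromℤ-+ x y = trans
  (cong₂ (λ a b → fromℤ (a + b)) (sym (ℤ.*-identityʳ x)) (sym (ℤ.*-identityʳ y)))
  (sym (cong₂ ℚ._+_ (fromℤ≡mkℚ x) (fromℤ≡mkℚ y)))

ℚ-noZeroDivisors : ∀ {x y} → x ℚ.* y ≡ 0ℚ → x ≡ 0ℚ ⊎ y ≡ 0ℚ
ℚ-noZeroDivisors {x} {y} xy≡0 with x ℚ.≟ 0ℚ
... | yes x≡0 = inj₁ x≡0
... | no  x≢0 = inj₂ (begin
  y                    ≡⟨ ℚ.*-identityˡ y ⟨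
  1ℚ ℚ.* y             ≡⟨ cong (ℚ._* y) (ℚ.*-inverseˡ x) ⟨
  1/ x ℚ.* x ℚ.* y     ≡⟨ ℚ.*-assoc (1/ x) x y ⟩
  1/ x ℚ.* (x ℚ.* y)   ≡⟨ cong (1/ x ℚ.*_) xy≡0 ⟩
  1/ x ℚ.* 0ℚ          ≡⟨ ℚ.*-zeroʳ (1/ x) ⟩
  0ℚ                   ∎)
  where
  open ≡-Reasoning
  instance _ = ≢-nonZero x≢0

module _ where

  open +-*-Solver

  interchange : ∀ a b c d → (a ℚ.+ b) ℚ.+ (c ℚ.+ d) ≡ (a ℚ.+ c) ℚ.+ (b ℚ.+ d)
  interchange = solve 4 (λ a b c d → (a :+ b) :+ (c :+ d) := (a :+ c) :+ (b :+ d)) refl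

  interchange-neg : ∀ a b c d → (a ℚ.+ b) ℚ.- (c ℚ.+ d) ≡ (a ℚ.- c) ℚ.+ (b ℚ.- d)
  interchange-neg = solve 4 (λ a b c d → (a :+ b) :- (c :+ d) := (a :- c) :+ (b :- d)) refl

  factor : ∀ a b c → a ℚ.* b ℚ.+ a ℚ.* c ≡ a ℚ.* (b ℚ.+ c)
  factor = solve 3 (λ a b c → a :* b :+ a :* c := a :* (b :+ c)) refl

  factor-neg : ∀ a b c → a ℚ.* b ℚ.- a ℚ.* c ≡ a ℚ.* (b ℚ.- c)
  factor-neg = solve 3 (λ a b c → a :* b :- a :* c := a :* (b :- c)) refl

  factorʳ-neg : ∀ a b c → (a ℚ.- b) ℚ.* c ≡ a ℚ.* c ℚ.- b ℚ.* c
  factorʳ-neg = solve 3 (λ a b c → (a :- b) :* c := a :* c :- b :* c) refl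

  half-sum : ∀ a b → a ≡ ½ ℚ.* ((a ℚ.+ b) ℚ.+ (a ℚ.- b))
  half-sum = solve 2 (λ a b → a := con ½ :* ((a :+ b) :+ (a :- b))) refl

  half-difference : ∀ a b → b ≡ ½ ℚ.* ((a ℚ.+ b) ℚ.- (a ℚ.- b))
  half-difference = solve 2 (λ a b → b := con ½ :* ((a :+ b) :- (a :- b))) refl

  symmetric : ∀ e g h → (h ℚ.+ e ℚ.* g) ℚ.+ (g ℚ.+ e ℚ.* h) ≡ (1ℚ ℚ.+ e) ℚ.* (g ℚ.+ h)
  symmetric = solve 3 (λ e g h → (h :+ e :* g) :+ (g :+ e :* h) := (con 1ℚ :+ e) :* (g :+ h)) refl

  antisymmetric : ∀ e g h → (h ℚ.+ e ℚ.* g) ℚ.- (g ℚ.+ e ℚ.* h) ≡ (ℚ.- 1ℚ ℚ.+ e) ℚ.* (g ℚ.- h)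
  antisymmetric = solve 3 (λ e g h → (h :+ e :* g) :- (g :+ e :* h) := (con (ℚ.- 1ℚ) :+ e) :* (g :- h)) refl

  -‿+-cancel : ∀ t e → t ≡ (t ℚ.- e) ℚ.+ e
  -‿+-cancel = solve 2 (λ t e → t := (t :- e) :+ e) refl

-- The Walsh transform

walsh : (CubeVertex n → ℚ) → CubeVertex n → ℚ
walsh f []          = f []
walsh f (false ∷ T) = walsh (λ u → f (false ∷ u)) T ℚ.+ walsh (λ u → f (true ∷ u)) T
walsh f (true ∷ T)  = walsh (λ u → f (false ∷ u)) T ℚ.- walsh (λ u → f (true ∷ u)) T

-- This is n - 2|T|, with |T| the number of entries `true`. The entries of T are also the steps of a
-- path from 0.
eigenvalue : CubeVertex n → ℤ
eigenvalue []          = 0ℤ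
eigenvalue (false ∷ T) = 1ℤ + eigenvalue T
eigenvalue (true ∷ T)  = -1ℤ + eigenvalue T

walsh-cong : {f g : CubeVertex n → ℚ} → (∀ u → f u ≡ g u) → ∀ T → walsh f T ≡ walsh g T
walsh-cong f≡g []          = f≡g []
walsh-cong f≡g (false ∷ T) =
  cong₂ ℚ._+_ (walsh-cong (λ u → f≡g (false ∷ u)) T) (walsh-cong (λ u → f≡g (true ∷ u)) T)
walsh-cong f≡g (true ∷ T)  =
  cong₂ ℚ._-_ (walsh-cong (λ u → f≡g (false ∷ u)) T) (walsh-cong (λ u → f≡g (true ∷ u)) T)

walsh-+ : ∀ (f g : CubeVertex n → ℚ) T → walsh (λ u → f u ℚ.+ g u) T ≡ walsh f T ℚ.+ walsh g T
walsh-+ f g []          = refl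
walsh-+ f g (false ∷ T) = trans
  (cong₂ ℚ._+_ (walsh-+ (λ u → f (false ∷ u)) (λ u → g (false ∷ u)) T)
              (walsh-+ (λ u → f (true ∷ u)) (λ u → g (true ∷ u)) T))
  (interchange
    (walsh (λ u → f (false ∷ u)) T) _ (walsh (λ u → f (true ∷ u)) T) _)
walsh-+ f g (true ∷ T)  = trans
  (cong₂ ℚ._-_ (walsh-+ (λ u → f (false ∷ u)) (λ u → g (false ∷ u)) T)
              (walsh-+ (λ u → f (true ∷ u)) (λ u → g (true ∷ u)) T))
  (interchange-neg
    (walsh (λ u → f (false ∷ u)) T) _ (walsh (λ u → f (true ∷ u)) T) _)

walsh-* : ∀ a (f : CubeVertex n → ℚ) T → walsh (λ u → a ℚ.* f u) T ≡ a ℚ.* walsh f T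
walsh-* a f []          = refl
walsh-* a f (false ∷ T) = trans
  (cong₂ ℚ._+_ (walsh-* a (λ u → f (false ∷ u)) T) (walsh-* a (λ u → f (true ∷ u)) T))
  (factor a (walsh (λ u → f (false ∷ u)) T) _)
walsh-* a f (true ∷ T)  = trans
  (cong₂ ℚ._-_ (walsh-* a (λ u → f (false ∷ u)) T) (walsh-* a (λ u → f (true ∷ u)) T))
  (factor-neg a (walsh (λ u → f (false ∷ u)) T) _)

walsh-0 : ∀ (T : CubeVertex n) → walsh (λ _ → 0ℚ) T ≡ 0ℚ
walsh-0 T = trans (walsh-* 0ℚ (λ _ → 0ℚ) T) (ℚ.*-zeroˡ (walsh (λ _ → 0ℚ) T))

walsh-combination : ∀ (c : Fin k → ℚ) (f : Fin k → CubeVertex n → ℚ) T →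
  walsh (λ u → sumℚ (λ l → c l ℚ.* f l u)) T ≡ sumℚ (λ l → c l ℚ.* walsh (f l) T)
walsh-combination {zero}  c f T = walsh-0 T
walsh-combination {suc k} c f T = trans
  (walsh-+ (λ u → c zero ℚ.* f zero u) (λ u → sumℚ (λ l → c (suc l) ℚ.* f (suc l) u)) T)
  (cong₂ ℚ._+_ (walsh-* (c zero) (f zero) T) (walsh-combination (c ∘ suc) (f ∘ suc) T))

-- The transforms of the two halves of f are half the sum and half the difference of the values at
-- `false ∷ T` and `true ∷ T`.
walsh-injective : (f : CubeVertex n → ℚ) → (∀ T → walsh f T ≡ 0ℚ) → ∀ u → f u ≡ 0ℚ
walsh-injective f f̂≡0 []          = f̂≡0 []
walsh-injective f f̂≡0 (false ∷ u) = walsh-injective (λ v → f (false ∷ v)) (λ T → begin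
  walsh (λ v → f (false ∷ v)) T
    ≡⟨ half-sum _ (walsh (λ v → f (true ∷ v)) T) ⟩
  ½ ℚ.* (walsh f (false ∷ T) ℚ.+ walsh f (true ∷ T))
    ≡⟨ cong₂ (λ a b → ½ ℚ.* (a ℚ.+ b)) (f̂≡0 (false ∷ T)) (f̂≡0 (true ∷ T)) ⟩
  0ℚ ∎) u
  where
  open ≡-Reasoning
walsh-injective f f̂≡0 (true ∷ u)  = walsh-injective (λ v → f (true ∷ v)) (λ T → begin
  walsh (λ v → f (true ∷ v)) T
    ≡⟨ half-difference (walsh (λ v → f (false ∷ v)) T) _ ⟩
  ½ ℚ.* (walsh f (false ∷ T) ℚ.- walsh f (true ∷ T))
    ≡⟨ cong₂ (λ a b → ½ ℚ.* (a ℚ.- b)) (f̂≡0 (false ∷ T)) (f̂≡0 (true ∷ T)) ⟩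
  0ℚ ∎) u
  where
  open ≡-Reasoning

-- Characters are eigenvectors: exchanging the halves of f preserves their sum and negates their
-- difference.
walsh-neighbourSum : ∀ (f : CubeVertex n → ℚ) T →
  walsh (ℚΣ.neighbourSum f) T ≡ fromℤ (eigenvalue T) ℚ.* walsh f T
walsh-neighbourSum f []          = sym (ℚ.*-zeroˡ (f []))
walsh-neighbourSum f (false ∷ T) = begin
  walsh (λ v → f (true ∷ v) ℚ.+ ℚΣ.neighbourSum f₀ v) T ℚ.+
  walsh (λ v → f (false ∷ v) ℚ.+ ℚΣ.neighbourSum f₁ v) T
    ≡⟨ cong₂ ℚ._+_ (walsh-+ f₁ (ℚΣ.neighbourSum f₀) T) (walsh-+ f₀ (ℚΣ.neighbourSum f₁) T) ⟩
  (w₁ ℚ.+ walsh (ℚΣ.neighbourSum f₀) T) ℚ.+ (w₀ ℚ.+ walsh (ℚΣ.neighbourSum f₁) T)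
    ≡⟨ cong₂ (λ a b → (w₁ ℚ.+ a) ℚ.+ (w₀ ℚ.+ b)) (walsh-neighbourSum f₀ T) (walsh-neighbourSum f₁ T) ⟩
  (w₁ ℚ.+ e ℚ.* w₀) ℚ.+ (w₀ ℚ.+ e ℚ.* w₁)
    ≡⟨ symmetric e w₀ w₁ ⟩
  (1ℚ ℚ.+ e) ℚ.* (w₀ ℚ.+ w₁)
    ≡⟨ cong (ℚ._* (w₀ ℚ.+ w₁)) (fromℤ-+ 1ℤ (eigenvalue T)) ⟨
  fromℤ (1ℤ + eigenvalue T) ℚ.* (w₀ ℚ.+ w₁) ∎
  where
  open ≡-Reasoning
  f₀ = λ v → f (false ∷ v)
  f₁ = λ v → f (true ∷ v)
  w₀ = walsh f₀ T
  w₁ = walsh f₁ T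
  e = fromℤ (eigenvalue T)
walsh-neighbourSum f (true ∷ T)  = begin
  walsh (λ v → f (true ∷ v) ℚ.+ ℚΣ.neighbourSum f₀ v) T ℚ.-
  walsh (λ v → f (false ∷ v) ℚ.+ ℚΣ.neighbourSum f₁ v) T
    ≡⟨ cong₂ ℚ._-_ (walsh-+ f₁ (ℚΣ.neighbourSum f₀) T) (walsh-+ f₀ (ℚΣ.neighbourSum f₁) T) ⟩
  (w₁ ℚ.+ walsh (ℚΣ.neighbourSum f₀) T) ℚ.- (w₀ ℚ.+ walsh (ℚΣ.neighbourSum f₁) T)
    ≡⟨ cong₂ (λ a b → (w₁ ℚ.+ a) ℚ.- (w₀ ℚ.+ b)) (walsh-neighbourSum f₀ T) (walsh-neighbourSum f₁ T) ⟩
  (w₁ ℚ.+ e ℚ.* w₀) ℚ.- (w₀ ℚ.+ e ℚ.* w₁)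
    ≡⟨ antisymmetric e w₀ w₁ ⟩
  (ℚ.- 1ℚ ℚ.+ e) ℚ.* (w₀ ℚ.- w₁)
    ≡⟨ cong (ℚ._* (w₀ ℚ.- w₁)) (fromℤ-+ -1ℤ (eigenvalue T)) ⟨
  fromℤ (-1ℤ + eigenvalue T) ℚ.* (w₀ ℚ.- w₁) ∎
  where
  open ≡-Reasoning
  f₀ = λ v → f (false ∷ v)
  f₁ = λ v → f (true ∷ v)
  w₀ = walsh f₀ T
  w₁ = walsh f₁ T
  e = fromℤ (eigenvalue T)

-- Transforming A f = θ f shows that θ - `eigenvalue T` annihilates `walsh f T`.
walsh-eigenvector : ∀ θ (f : CubeVertex n → ℚ) → (∀ u → ℚΣ.neighbourSum f u ≡ fromℤ θ ℚ.* f u) →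
                    ∀ T → θ ≢ eigenvalue T → walsh f T ≡ 0ℚ
walsh-eigenvector θ f Af≡θf T θ≢ =
  [ (λ t-e≡0 → contradiction (fromℤ-injective (cancel t-e≡0)) θ≢) , id ]′ (ℚ-noZeroDivisors product≡0)
  where
  open ≡-Reasoning
  t = fromℤ θ
  e = fromℤ (eigenvalue T)
  w = walsh f T
  product≡0 : (t ℚ.- e) ℚ.* w ≡ 0ℚ
  product≡0 = begin
    (t ℚ.- e) ℚ.* w
      ≡⟨ factorʳ-neg t e w ⟩
    t ℚ.* w ℚ.- e ℚ.* w
      ≡⟨ cong (λ z → t ℚ.* w ℚ.- z)
           (trans (sym (walsh-neighbourSum f T)) (trans (walsh-cong Af≡θf T) (walsh-* t f T))) ⟩
    t ℚ.* w ℚ.- t ℚ.* w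
      ≡⟨ ℚ.+-inverseʳ (t ℚ.* w) ⟩
    0ℚ ∎
  cancel : t ℚ.- e ≡ 0ℚ → t ≡ e
  cancel t-e≡0 = begin
    t                 ≡⟨ -‿+-cancel t e ⟩
    (t ℚ.- e) ℚ.+ e   ≡⟨ cong (ℚ._+ e) t-e≡0 ⟩
    0ℚ ℚ.+ e          ≡⟨ ℚ.+-identityˡ e ⟩
    e                 ∎

-- Dimensions of the eigenspaces

vertices : ∀ n → List (CubeVertex n)
vertices zero    = [] ∷ []
vertices (suc n) = map (false ∷_) (vertices n) ++ map (true ∷_) (vertices n)

∈-vertices : (T : CubeVertex n) → T ∈ vertices n
∈-vertices []          = here refl
∈-vertices (false ∷ T) = ∈-++⁺ˡ (∈-map⁺ (false ∷_) (∈-vertices T))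
∈-vertices (true ∷ T)  = ∈-++⁺ʳ _ (∈-map⁺ (true ∷_) (∈-vertices T))

map-eigenvalue : ∀ n a → map (λ T → eigenvalue T + a) (vertices n) ≡ pathEnds n a
map-eigenvalue zero    a = cong (_∷ []) (ℤ.+-identityˡ a)
map-eigenvalue (suc n) a = begin
  map (λ T → eigenvalue T + a) (map (false ∷_) (vertices n) ++ map (true ∷_) (vertices n))
    ≡⟨ List.map-++ _ (map (false ∷_) (vertices n)) _ ⟩
  map (λ T → eigenvalue T + a) (map (false ∷_) (vertices n)) ++
  map (λ T → eigenvalue T + a) (map (true ∷_) (vertices n))
    ≡⟨ cong₂ _++_ (step 1ℤ false (λ T → refl)) (step -1ℤ true (λ T → refl)) ⟩
  pathEnds n (1ℤ + a) ++ pathEnds n (-1ℤ + a) ∎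
  where
  open ≡-Reasoning
  step : ∀ x b → (∀ T → eigenvalue (b ∷ T) ≡ x + eigenvalue T) →
         map (λ T → eigenvalue T + a) (map (b ∷_) (vertices n)) ≡ pathEnds n (x + a)
  step x b eq = trans (sym (List.map-∘ (vertices n)))
    (trans (List.map-cong (λ T → trans (cong (_+ a) (trans (eq T) (ℤ.+-comm x (eigenvalue T))))
                                       (ℤ.+-assoc (eigenvalue T) x a)) (vertices n))
           (map-eigenvalue n (x + a)))

module _ {n} {A : Matrix ℤ (2 ^ n)} (cube : IsCubeAdjacencyMatrix n A) where

  open IsCubeAdjacencyMatrix cube
  open Ordering ordering
  open Elimination ℚ.+-*-commutativeRing using (nontrivialSolution)

  eigenspace-neighbourSum : ∀ θ v → InEigenspace A θ v →
                            ∀ u → ℚΣ.neighbourSum (v ∘ from) u ≡ fromℤ θ ℚ.* v (from u)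
  eigenspace-neighbourSum θ v eigen u = begin
    ℚΣ.neighbourSum (v ∘ from) u
      ≡⟨ cong (ℚΣ.neighbourSum (v ∘ from)) (to-from u) ⟨
    ℚΣ.neighbourSum (v ∘ from) (to (from u))
      ≡⟨ ℚΣ.sum-neighbours ordering (from u) (λ j → fromℤ (A (from u) j) ℚ.* v j) (v ∘ from)
           (λ j adj → trans (cong (λ a → fromℤ a ℚ.* v j) (adjacent (from u) j adj))
                            (trans (ℚ.*-identityˡ (v j)) (cong v (sym (from-to j)))))
           (λ j ¬adj → trans (cong (λ a → fromℤ a ℚ.* v j) (nonadjacent (from u) j ¬adj)) (ℚ.*-zeroˡ (v j))) ⟨
    sumℚ (λ j → fromℤ (A (from u) j) ℚ.* v j)
      ≡⟨ eigen (from u) ⟩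
    fromℤ θ ℚ.* v (from u) ∎
    where open ≡-Reasoning

  -- With more basis vectors than vertices of eigenvalue θ, some nontrivial combination has a
  -- transform vanishing at these vertices, and everywhere by `walsh-eigenvector`. Injectivity of
  -- the transform contradicts independence.
  dimension≤ : ∀ {θ m} → EigenspaceBasis A θ m → m ≤ length (filter (λ T → θ ℤ.≟ eigenvalue T) (vertices n))
  dimension≤ {θ} {m} B = ℕ.≮⇒≥ λ lt → dependent
    (nontrivialSolution (ℚ._≟ 0ℚ) ℚ-noZeroDivisors ℚ.1≢0 (λ x l → walsh (b l) (List.lookup Ts x)) lt)
    where
    open EigenspaceBasis B
    Ts = filter (λ T → θ ℤ.≟ eigenvalue T) (vertices n)
    b : Fin m → CubeVertex n → ℚ
    b l = basis l ∘ from
    vanish : ∀ (u : Fin m → ℚ) → (∀ x → sumℚ (λ l → u l ℚ.* walsh (b l) (List.lookup Ts x)) ≡ 0ℚ) →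
             ∀ T → sumℚ (λ l → u l ℚ.* walsh (b l) T) ≡ 0ℚ
    vanish u sol T with θ ℤ.≟ eigenvalue T
    ... | yes θ≡ = subst (λ T → sumℚ (λ l → u l ℚ.* walsh (b l) T) ≡ 0ℚ) (sym (lookup-index T∈)) (sol (index T∈))
      where
      T∈ : T ∈ Ts
      T∈ = ∈-filter⁺ (λ T → θ ℤ.≟ eigenvalue T) (∈-vertices T) θ≡
    ... | no θ≢ = ℚΣ.sum-ε _ (λ l → trans
      (cong (u l ℚ.*_) (walsh-eigenvector θ (b l) (eigenspace-neighbourSum θ (basis l) (eigen l)) T θ≢))
      (ℚ.*-zeroʳ (u l)))
    dependent : ¬ (Σ[ u ∈ (Fin m → ℚ) ] (∃[ l ] u l ≢ 0ℚ) ×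
                   (∀ x → sumℚ (λ l → u l ℚ.* walsh (b l) (List.lookup Ts x)) ≡ 0ℚ))
    dependent (u , (l , ul≢0) , sol) = ul≢0 (independent u (λ i → trans
      (cong (λ j → sumℚ (λ l → u l ℚ.* basis l j)) (sym (from-to i)))
      (walsh-injective (λ v → sumℚ (λ l → u l ℚ.* b l v))
        (λ T → trans (walsh-combination u b T) (vanish u sol T)) (to i))) l)

-- The spectrum as a multiset

occurrences : ℤ → List ℤ → ℕ
occurrences θ xs = length (filter (θ ℤ.≟_) xs)

occurrences⇒∈ : ∀ θ xs → 0 < occurrences θ xs → θ ∈ xs
occurrences⇒∈ θ xs 0<occ with filter (θ ℤ.≟_) xs in eq
... | y ∷ ys with ∈-filter⁻ (θ ℤ.≟_) {xs = xs} (subst (y ∈_) (sym eq) (here refl))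
...   | y∈xs , refl = y∈xs

occurrences-∷-≤ : ∀ θ x {xs ys} →
  occurrences θ (x ∷ xs) ≤ occurrences θ (x ∷ ys) → occurrences θ xs ≤ occurrences θ ys
occurrences-∷-≤ θ x le with θ ℤ.≟ x
... | yes _ = s≤s⁻¹ le
... | no  _ = le

-- Equal lengths leave no room for a strict inequality, so upper bounds for the multiplicities
-- determine the multiset.
occurrences-≤⇒↭ : ∀ xs ys → length xs ≡ length ys →
  (∀ θ → occurrences θ xs ≤ occurrences θ ys) → xs ↭ ys
occurrences-≤⇒↭ []       []       _   _  = ↭-refl
occurrences-≤⇒↭ (x ∷ xs) ys       len le
  with ∈-∃++ (occurrences⇒∈ x ys (ℕ.≤-trans
         (subst (1 ≤_) (sym (cong length (List.filter-accept (x ℤ.≟_) {x} {xs} refl))) (s≤s z≤n)) (le x)))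
... | us , vs , refl = ↭-trans
  (prep x (occurrences-≤⇒↭ xs (us ++ vs)
    (ℕ.suc-injective (trans len (↭-length (shift x us vs))))
    (λ θ → occurrences-∷-≤ θ x (ℕ.≤-trans (le θ)
      (ℕ.≤-reflexive (↭-length (filter-↭ (θ ℤ.≟_) (shift x us vs))))))))
  (↭-sym (shift x us vs))

module _ {P : Pred ℤ 0ℓ} (P? : Decidable P) where

  count-toList : (v : Vec ℤ N) → count P? v ≡ length (filter P? (toList v))
  count-toList []      = refl
  count-toList (x ∷ v) with P? x
  ... | yes _ = cong suc (count-toList v)
  ... | no  _ = count-toList v

  count-all : (v : Vec ℤ N) → (∀ x → P x) → count P? v ≡ N
  count-all []      all = refl
  count-all (x ∷ v) all with P? x
  ... | yes _ = cong suc (count-all v all)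
  ... | no ¬p = contradiction (all x) ¬p

length-pathEnds : ∀ n a → length (pathEnds n a) ≡ 2 ^ n
length-pathEnds zero    a = refl
length-pathEnds (suc n) a = trans (List.length-++ (pathEnds n (1ℤ + a)))
  (cong₂ ℕ._+_ (length-pathEnds n (1ℤ + a)) (trans (length-pathEnds n (-1ℤ + a)) (sym (ℕ.+-identityʳ _))))

-- Each step changes the parity.
pathEnds-even : ∀ n a → + 2 ∣ℤ + n + a → All (+ 2 ∣ℤ_) (pathEnds n a)
pathEnds-even zero    a even = subst (+ 2 ∣ℤ_) (ℤ.+-identityˡ a) even ∷ []
pathEnds-even (suc n) a even = All.++⁺
  (pathEnds-even n (1ℤ + a) (subst (+ 2 ∣ℤ_) (lemma₁ (+ n) a) even))
  (pathEnds-even n (-1ℤ + a) (subst (+ 2 ∣ℤ_) (lemma₂ (+ n) a) (∣m∣n⇒∣m+n even (divides -1ℤ refl))))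
  where
  lemma₁ : ∀ n a → 1ℤ + n + a ≡ n + (1ℤ + a)
  lemma₁ = solve-∀
  lemma₂ : ∀ n a → 1ℤ + n + a + (-1ℤ + -1ℤ) ≡ n + (-1ℤ + a)
  lemma₂ = solve-∀

count-difference : {P Q : Pred ℤ 0ℓ} (P? : Decidable P) (Q? : Decidable Q) → (∀ {x} → Q x → P x) →
  (v : Vec ℤ N) → count (λ x → P? x ×-dec ¬? (Q? x)) v ℕ.+ count Q? v ≡ count P? v
count-difference P? Q? Q⊆P []      = refl
count-difference P? Q? Q⊆P (x ∷ v) with P? x | Q? x
... | yes _ | yes _ = trans (ℕ.+-suc _ _) (cong suc (count-difference P? Q? Q⊆P v))
... | yes _ | no  _ = cong suc (count-difference P? Q? Q⊆P v)
... | no ¬p | yes q = contradiction (Q⊆P q) ¬p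
... | no  _ | no  _ = count-difference P? Q? Q⊆P v

count-exactly : ∀ i (v : Vec ℤ N) →
  count (exactlyDivides? 2 i) v ℕ.+ count (+ (2 ^ suc i) ∣?_) v ≡ count (+ (2 ^ i) ∣?_) v
count-exactly i = count-difference (+ (2 ^ i) ∣?_) (+ (2 ^ suc i) ∣?_) (∣-trans (∣ᵤ⇒∣ (ℕ.divides 2 refl)))

occurrences-pathEnds : ∀ n θ →
  length (filter (λ T → θ ℤ.≟ eigenvalue T) (vertices n)) ≡ occurrences θ (pathEnds n 0ℤ)
occurrences-pathEnds n θ = trans (lemma (vertices n))
  (cong (occurrences θ)
    (trans (List.map-cong (λ T → sym (ℤ.+-identityʳ (eigenvalue T))) (vertices n)) (map-eigenvalue n 0ℤ)))
  where
  lemma : ∀ Ts → length (filter (λ T → θ ℤ.≟ eigenvalue T) Ts) ≡ occurrences θ (map eigenvalue Ts)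
  lemma []       = refl
  lemma (T ∷ Ts) with θ ℤ.≟ eigenvalue T
  ... | yes _ = cong suc (lemma Ts)
  ... | no  _ = lemma Ts

spectrum↭pathEnds : ∀ {n} {A : Matrix ℤ (2 ^ n)} → IsCubeAdjacencyMatrix n A →
                    (θs : Vec ℤ (2 ^ n)) → IsSpectrum A θs → toList θs ↭ pathEnds n 0ℤ
spectrum↭pathEnds {n} cube θs spectrum = occurrences-≤⇒↭ (toList θs) (pathEnds n 0ℤ)
  (trans (Vec.length-toList θs) (sym (length-pathEnds n 0ℤ)))
  (λ θ → subst₂ _≤_ (count-toList (θ ℤ.≟_) θs) (occurrences-pathEnds n θ) (dimension≤ cube (spectrum θ)))

-- Gives h = H - 2, the parameter of the reflection argument; the barrier H - 1 is then `suc h`.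
2^suc≡2+ : ∀ i → ∃[ h ] suc (suc h) ≡ 2 ^ suc i
2^suc≡2+ zero    = 0 , refl
2^suc≡2+ (suc i) with 2^suc≡2+ i
... | h , eq = h ℕ.+ suc (suc h) , trans (cong (suc (suc h) ℕ.+_) (sym (ℕ.+-identityʳ _))) (cong (2 ℕ.*_) eq)

corollary5p4 : (n : ℕ) → .{{_ : NonZero n}} → 2 ∣ n →
    (A : Matrix ℤ (2 ^ n)) → IsCubeAdjacencyMatrix n A →
    (θs : Vec ℤ (2 ^ n)) → IsSpectrum A θs →
    (i m : ℕ) → ElementaryDivisorMultiplicity 2 i A m →
    m ≡ count (exactlyDivides? 2 (suc i)) θs
corollary5p4 n 2∣n A cube θs spectrum i m
  (D , diag , (P , Q , (P⁻¹ , _ , P⁻¹P) , (Q⁻¹ , QQ⁻¹ , _) , PAQ) , count≡m) =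
  -- The numbers of entries divisible by a power of 2, zeros included, are compared in `divisible`;
  -- exact divisibility follows by taking differences.
  ℕ.+-cancelʳ-≡ (count (+ (2 ^ suc i) ∣?_) (diagonal D)) _ _ (begin
    m ℕ.+ count (+ (2 ^ suc i) ∣?_) (diagonal D)
      ≡⟨ cong (ℕ._+ _) (sym count≡m) ⟩
    count (exactlyDivides? 2 i) (diagonal D) ℕ.+ count (+ (2 ^ suc i) ∣?_) (diagonal D)
      ≡⟨ count-exactly i (diagonal D) ⟩
    count (+ (2 ^ i) ∣?_) (diagonal D)
      ≡⟨ divisible i ⟩
    count (+ (2 ^ suc i) ∣?_) θs
      ≡⟨ count-exactly (suc i) θs ⟨
    count (exactlyDivides? 2 (suc i)) θs ℕ.+ count (+ (2 ^ suc (suc i)) ∣?_) θs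
      ≡⟨ cong (count (exactlyDivides? 2 (suc i)) θs ℕ.+_) (sym (divisible (suc i))) ⟩
    count (exactlyDivides? 2 (suc i)) θs ℕ.+ count (+ (2 ^ suc i) ∣?_) (diagonal D) ∎)
  where
  open ≡-Reasoning

  θs-count : ∀ j → count (+ (2 ^ j) ∣?_) θs ≡ length (filter (+ (2 ^ j) ∣?_) (pathEnds n 0ℤ))
  θs-count j = trans (count-toList _ θs) (↭-length (filter-↭ _ (spectrum↭pathEnds cube θs spectrum)))

  divisible : ∀ j → count (+ (2 ^ j) ∣?_) (diagonal D) ≡ count (+ (2 ^ suc j) ∣?_) θs
  -- For 2⁰ this amounts to all eigenvalues being even, as n is.
  divisible zero = begin
    count (+ 1 ∣?_) (diagonal D)
      ≡⟨ count-all (+ 1 ∣?_) (diagonal D) (λ x → divides x (sym (ℤ.*-identityʳ x))) ⟩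
    2 ^ n
      ≡⟨ length-pathEnds n 0ℤ ⟨
    length (pathEnds n 0ℤ)
      ≡⟨ cong length (List.filter-all (+ 2 ∣?_)
           (pathEnds-even n 0ℤ (subst (+ 2 ∣ℤ_) (sym (ℤ.+-identityʳ (+ n))) (∣ᵤ⇒∣ 2∣n)))) ⟨
    length (filter (+ 2 ∣?_) (pathEnds n 0ℤ))
      ≡⟨ θs-count 1 ⟨
    count (+ 2 ∣?_) θs ∎
  divisible (suc j) with 2^suc≡2+ j
  ... | h , 2+h≡2^1+j = begin
    count (+ (2 ^ suc j) ∣?_) (diagonal D)
      ≡⟨ CubeMatrix.count≡goodPaths cube diag P P⁻¹ Q Q⁻¹ P⁻¹P QQ⁻¹ PAQ 2∣n j (suc h) 2+h≡2^1+j ⟩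
    goodPaths n 0 (suc h)
      ≡⟨ goodPaths≡folded h (subst (2 ∣_) (sym 2+h≡2^1+j) (ℕ.m∣m*n (2 ^ j))) n 0 (suc h) refl 2∣n ⟩
    length (filter (+ (2 ℕ.* suc (suc h)) ∣?_) (pathEnds n 0ℤ))
      ≡⟨ cong (λ H → length (filter (+ (2 ℕ.* H) ∣?_) (pathEnds n 0ℤ))) 2+h≡2^1+j ⟩
    length (filter (+ (2 ^ suc (suc j)) ∣?_) (pathEnds n 0ℤ))
      ≡⟨ θs-count (suc (suc j)) ⟨
    count (+ (2 ^ suc (suc j)) ∣?_) θs ∎
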